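{- For $i=1,2$ let $\mathcal{G}_i$ be an $r_i$-regular graph with $n_i$ vertices, and let $\nu_{11},\ldots,\nu_{1n_1}$ be the signless Laplacian eigenvalues of $\mathcal{G}_1$. Then $\mathcal{G}_1\circledast\mathcal{G}_2$ is signless Laplacian integral if and only if $\mathcal{G}_2$ is signless Laplacian integral and, for each $i=1,2,\ldots,n_1$, the roots of $x-n_2-n_2\nu_{1i}-n_2\chi_{Q_{\mathcal{G}_2}}(x-n_2)$ are integers.
   Context: All graphs are simple, finite and undirected. $Q_{\mathcal{G}}=D_{\mathcal{G}}+A_{\mathcal{G}}$ is the signless Laplacian matrix (degree matrix plus adjacency matrix). A graph is signless Laplacian integral if all eigenvalues of its signless Laplacian matrix are integers. The signless Laplacian coronal of a graph $\mathcal{G}$ on $n$ vertices is the rational function $\chi_{Q_{\mathcal{G}}}(x)=\mathbf{1}_n^T(xI_n-Q_{\mathcal{G}})^{ -1}\mathbf{1}_n$, $\mathbf{1}_n$ the all-ones vector; "roots" of the expression in the claim are the values of $x$ at which this rational function vanishes. The graph product $\mathcal{G}_1\circledast\mathcal{G}_2$ of $\mathcal{G}_1$ (vertices $u_1,\ldots,u_{n_1}$) and $\mathcal{G}_2$ (vertices $v_1,\ldots,v_{n_2}$) has vertex set $\{a_{ik},b_{ik}:1\le i\le n_1,1\le k\le n_2\}$ and edges: $a_{ik}a_{jl}$ for all $k,l$ whenever $u_iu_j\in E(\mathcal{G}_1)$; $b_{ri}b_{rj}$ for all $r$ whenever $v_iv_j\in E(\mathcal{G}_2)$; $a_{ip}b_{iq}$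 for all $i,p,q$. -}

module Defs where

open import Algebra.Bundles using (CommutativeRing)
open import Algebra.Bundles.Raw using (RawRing)
open import Algebra.Definitions.RawMonoid using (sum) renaming (_×_ to times)
open import Data.Bool.Base using (if_then_else_)
open import Data.Fin.Base using (Fin; splitAt; remQuot)
open import Data.Fin.Properties using () renaming (_≟_ to _≟ᶠ_)
open import Data.Integer.Base using (ℤ; +_; -[1+_])
open import Data.List.Base using (List; []; _∷_; _∷ʳ_; map; foldr; length)
open import Data.Nat.Base as ℕ using (ℕ; zero; suc)
open import Data.Product.Base using (∃-syntax; _×_; _,_)
open import Data.Sum.Base as Sum using (_⊎_; inj₁; inj₂)
open import Data.Vec.Base using (count; allFin)
open import Data.Vec.Functional using (Vector)
open import Level using (_⊔_; 0ℓ) renaming (suc to lsuc)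
open import Relation.Binary.Core using (Rel)
open import Relation.Binary.Definitions using (Symmetric; Irreflexive; Decidable)
open import Relation.Binary.PropositionalEquality as ≡ using (_≡_)
open import Relation.Binary.Structures using (IsStrictTotalOrder)
open import Relation.Nullary.Decidable using (does; yes; no; _×-dec_)
open import Relation.Nullary.Negation using (¬_)

import Relation.Binary.Reasoning.Setoid as SetoidReasoning

record Graph (n : ℕ) : Set₁ where
  infix 4 _~_ _~?_
  field
    _~_      : Rel (Fin n) 0ℓ
    _~?_     : Decidable _~_
    ~-sym    : Symmetric _~_
    ~-irrefl : Irreflexive _≡_ _~_

  degree : Fin n → ℕ
  degree i = count (i ~?_) (allFin n)

Regular : ∀ {n} → ℕ → Graph n → Set
Regular r G = ∀ i → Graph.degree G i ≡ r

-- inj₁ (i , k) is the vertex a_{ik}, and inj₂ (i , k) is b_{ik}.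
⊛-Vertex : ℕ → ℕ → Set
⊛-Vertex n₁ n₂ = (Fin n₁ × Fin n₂) ⊎ (Fin n₁ × Fin n₂)

⊛-vertex : ∀ n₁ n₂ → Fin (n₁ ℕ.* n₂ ℕ.+ n₁ ℕ.* n₂) → ⊛-Vertex n₁ n₂
⊛-vertex n₁ n₂ x = Sum.map (remQuot n₂) (remQuot n₂) (splitAt (n₁ ℕ.* n₂) x)

module _ {n₁ n₂ : ℕ} (G₁ : Graph n₁) (G₂ : Graph n₂) where
  private
    module G₁ = Graph G₁
    module G₂ = Graph G₂

  ⊛-Adjacent : Rel (⊛-Vertex n₁ n₂) 0ℓ
  ⊛-Adjacent (inj₁ (i , k)) (inj₁ (j , l)) = i G₁.~ j
  ⊛-Adjacent (inj₂ (r , i)) (inj₂ (s , j)) = r ≡ s × i G₂.~ j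
  ⊛-Adjacent (inj₁ (i , p)) (inj₂ (j , q)) = i ≡ j
  ⊛-Adjacent (inj₂ (i , q)) (inj₁ (j , p)) = i ≡ j

  ⊛-adjacent? : Decidable ⊛-Adjacent
  ⊛-adjacent? (inj₁ (i , k)) (inj₁ (j , l)) = i G₁.~? j
  ⊛-adjacent? (inj₂ (r , i)) (inj₂ (s , j)) = (r ≟ᶠ s) ×-dec (i G₂.~? j)
  ⊛-adjacent? (inj₁ (i , p)) (inj₂ (j , q)) = i ≟ᶠ j
  ⊛-adjacent? (inj₂ (i , q)) (inj₁ (j , p)) = i ≟ᶠ j

  ⊛-sym : ∀ u v → ⊛-Adjacent u v → ⊛-Adjacent v u
  ⊛-sym (inj₁ _) (inj₁ _) u~v         = G₁.~-sym u~v
  ⊛-sym (inj₂ _) (inj₂ _) (r≡s , i~j) = ≡.sym r≡s , G₂.~-sym i~j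
  ⊛-sym (inj₁ _) (inj₂ _) i≡j         = ≡.sym i≡j
  ⊛-sym (inj₂ _) (inj₁ _) i≡j         = ≡.sym i≡j

  ⊛-irrefl : ∀ u → ¬ ⊛-Adjacent u u
  ⊛-irrefl (inj₁ _) i~i       = G₁.~-irrefl ≡.refl i~i
  ⊛-irrefl (inj₂ _) (_ , i~i) = G₂.~-irrefl ≡.refl i~i

  infix 7 _⊛_
  _⊛_ : Graph (n₁ ℕ.* n₂ ℕ.+ n₁ ℕ.* n₂)
  _⊛_ = record
    { _~_      = λ x y → ⊛-Adjacent (vertex x) (vertex y)
    ; _~?_     = λ x y → ⊛-adjacent? (vertex x) (vertex y)
    ; ~-sym    = λ {x} {y} → ⊛-sym (vertex x) (vertex y)
    ; ~-irrefl = λ { {x} ≡.refl → ⊛-irrefl (vertex x) }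
    }
    where vertex = ⊛-vertex n₁ n₂

module Matrices {c ℓ} (R : RawRing c ℓ) where
  open RawRing R

  infixl 7 _*ᵥ_ _*ᴹ_ _∙ᵥ_ _·ᵥ_
  infixl 6 _+ᴹ_ _-ᴹ_
  infix  4 _≈ᵥ_ _≈ᴹ_

  ∑ : ∀ {n} → Vector Carrier n → Carrier
  ∑ = sum +-rawMonoid

  fromℕ : ℕ → Carrier
  fromℕ n = times +-rawMonoid n 1#

  fromℤ : ℤ → Carrier
  fromℤ (+ n)    = fromℕ n
  fromℤ -[1+ n ] = - fromℕ (suc n)

  Matrix : ℕ → Set c
  Matrix n = Fin n → Fin n → Carrier

  _≈ᵥ_ : ∀ {n} → Rel (Vector Carrier n) ℓ
  v ≈ᵥ w = ∀ i → v i ≈ w i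

  _≈ᴹ_ : ∀ {n} → Rel (Matrix n) ℓ
  A ≈ᴹ B = ∀ i j → A i j ≈ B i j

  𝟎 𝟏 : ∀ {n} → Vector Carrier n
  𝟎 _ = 0#
  𝟏 _ = 1#

  _·ᵥ_ : ∀ {n} → Carrier → Vector Carrier n → Vector Carrier n
  (a ·ᵥ v) i = a * v i

  -- The scalar vᵀ w.
  _∙ᵥ_ : ∀ {n} → Vector Carrier n → Vector Carrier n → Carrier
  v ∙ᵥ w = ∑ λ i → v i * w i

  _*ᵥ_ : ∀ {n} → Matrix n → Vector Carrier n → Vector Carrier n
  (A *ᵥ v) i = A i ∙ᵥ v

  _*ᴹ_ : ∀ {n} → Matrix n → Matrix n → Matrix n
  (A *ᴹ B) i j = A i ∙ᵥ λ k → B k j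

  _+ᴹ_ : ∀ {n} → Matrix n → Matrix n → Matrix n
  (A +ᴹ B) i j = A i j + B i j

  _-ᴹ_ : ∀ {n} → Matrix n → Matrix n → Matrix n
  (A -ᴹ B) i j = A i j + - B i j

  diagonal : ∀ {n} → Vector Carrier n → Matrix n
  diagonal d i j = if does (i ≟ᶠ j) then d i else 0#

  scalar : ∀ {n} → Carrier → Matrix n
  scalar a = diagonal λ _ → a

  IsInverse : ∀ {n} → Matrix n → Matrix n → Set ℓ
  IsInverse A B = A *ᴹ B ≈ᴹ scalar 1# × B *ᴹ A ≈ᴹ scalar 1#

  adjacencyMatrix : ∀ {n} → Graph n → Matrix n
  adjacencyMatrix G i j = if does (i ~? j) then 1# else 0#
    where open Graph G

  degreeMatrix : ∀ {n} → Graph n → Matrix n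
  degreeMatrix G = diagonal λ i → fromℕ (Graph.degree G i)

  signlessLaplacian : ∀ {n} → Graph n → Matrix n
  signlessLaplacian G = degreeMatrix G +ᴹ adjacencyMatrix G

module Polynomials {c ℓ} (R : RawRing c ℓ) where
  open RawRing R

  -- Coefficients, constant term first; trailing zeros are allowed.
  Poly : Set c
  Poly = List Carrier

  coeff : Poly → ℕ → Carrier
  coeff []      _       = 0#
  coeff (a ∷ p) zero    = a
  coeff (a ∷ p) (suc n) = coeff p n

  infixl 7 _*ᴾ_
  infixl 6 _+ᴾ_
  infix  4 _≈ᴾ_

  _≈ᴾ_ : Rel Poly ℓ
  p ≈ᴾ q = ∀ n → coeff p n ≈ coeff q n

  _+ᴾ_ : Poly → Poly → Poly
  []      +ᴾ q       = q
  (a ∷ p) +ᴾ []      = a ∷ p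
  (a ∷ p) +ᴾ (b ∷ q) = (a + b) ∷ (p +ᴾ q)

  _*ᴾ_ : Poly → Poly → Poly
  []      *ᴾ q = []
  (a ∷ p) *ᴾ q = map (a *_) q +ᴾ (0# ∷ (p *ᴾ q))

  -ᴾ_ : Poly → Poly
  -ᴾ_ = map (-_)

  evaluate : Poly → Carrier → Carrier
  evaluate p x = foldr (λ a y → a + x * y) 0# p

-- The reals enter only as a real closed field with decidable order.
-- The field of real numbers is one classically; constructively, so is
-- the field of real algebraic numbers, which contains all eigenvalues
-- of symmetric integer matrices.
record RealClosedField c ℓ₁ ℓ₂ : Set (lsuc (c ⊔ ℓ₁ ⊔ ℓ₂)) where
  infix 4 _<_
  field
    commutativeRing : CommutativeRing c ℓ₁

  open CommutativeRing commutativeRing public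
  open Polynomials rawRing public

  field
    0≉1                : 0# ≉ 1#
    inverse            : ∀ x → x ≉ 0# → ∃[ y ] x * y ≈ 1#
    _<_                : Rel Carrier ℓ₂
    isStrictTotalOrder : IsStrictTotalOrder _≈_ _<_
    +-monoʳ-<          : ∀ x {y z} → y < z → x + y < x + z
    *-pos              : ∀ {x y} → 0# < x → 0# < y → 0# < x * y
    sqrt               : ∀ x → 0# < x → ∃[ y ] y * y ≈ x
    -- Here p ∷ʳ 1# is a monic polynomial of degree length p.
    oddDegreeRoot      : ∀ p k → length p ≡ suc (2 ℕ.* k) →
                         ∃[ x ] evaluate (p ∷ʳ 1#) x ≈ 0#

  open IsStrictTotalOrder isStrictTotalOrder public using (_≟_)

module Over {c ℓ₁ ℓ₂} (F : RealClosedField c ℓ₁ ℓ₂) where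
  open RealClosedField F
  open Matrices rawRing public

  IsInteger : Carrier → Set ℓ₁
  IsInteger x = ∃[ z ] x ≈ fromℤ z

  IsEigenvalue : ∀ {n} → Matrix n → Carrier → Set (c ⊔ ℓ₁)
  IsEigenvalue A λ′ = ∃[ v ] ¬ (v ≈ᵥ 𝟎) × A *ᵥ v ≈ᵥ λ′ ·ᵥ v

  IsBasis : ∀ {n} → (Fin n → Vector Carrier n) → Set (c ⊔ ℓ₁)
  IsBasis {n} b =
      (∀ a → combination a ≈ᵥ 𝟎 → a ≈ᵥ 𝟎)
    × (∀ v → ∃[ a ] v ≈ᵥ combination a)
    where
    combination : Vector Carrier n → Vector Carrier n
    combination a i = ∑ λ j → a j * b j i

  -- ν lists the eigenvalues of a symmetric matrix, each repeated
  -- according to the dimension of its eigenspace.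
  AreEigenvalues : ∀ {n} → Matrix n → Vector Carrier n → Set (c ⊔ ℓ₁)
  AreEigenvalues A ν =
    ∃[ b ] IsBasis b × (∀ i → A *ᵥ b i ≈ᵥ ν i ·ᵥ b i)

  SignlessLaplacianIntegral : ∀ {n} → Graph n → Set (c ⊔ ℓ₁)
  SignlessLaplacianIntegral G =
    ∀ x → IsEigenvalue (signlessLaplacian G) x → IsInteger x

  private
    open SetoidReasoning setoid

  coeff-+ : ∀ p q n → coeff (p +ᴾ q) n ≈ coeff p n + coeff q n
  coeff-+ []      q       n       = sym (+-identityˡ _)
  coeff-+ (a ∷ p) []      n       = sym (+-identityʳ _)
  coeff-+ (a ∷ p) (b ∷ q) zero    = refl
  coeff-+ (a ∷ p) (b ∷ q) (suc n) = coeff-+ p q n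

  coeff-map : ∀ a p n → coeff (map (a *_) p) n ≈ a * coeff p n
  coeff-map a []      n       = sym (zeroʳ a)
  coeff-map a (b ∷ p) zero    = refl
  coeff-map a (b ∷ p) (suc n) = coeff-map a p n

  coeff-∷* : ∀ a p q n → coeff ((a ∷ p) *ᴾ q) n ≈ a * coeff q n + coeff (0# ∷ (p *ᴾ q)) n
  coeff-∷* a p q n = trans (coeff-+ (map (a *_) q) _ n) (+-congʳ (coeff-map a q n))

  coeff-*∷-zero : ∀ p {b} q → b ≈ 0# → coeff (p *ᴾ (b ∷ q)) 0 ≈ 0#
  coeff-*∷-zero []      q b≈0 = refl
  coeff-*∷-zero (a ∷ p) {b} q b≈0 = begin
    a * b + 0#  ≈⟨ +-identityʳ _ ⟩
    a * b       ≈⟨ *-congˡ b≈0 ⟩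
    a * 0#      ≈⟨ zeroʳ a ⟩
    0#          ∎

  coeff-*∷-suc : ∀ p {b} q n → b ≈ 0# →
                 coeff (p *ᴾ (b ∷ q)) (suc n) ≈ coeff (p *ᴾ q) n
  coeff-*∷-suc []      q n b≈0 = refl
  coeff-*∷-suc (a ∷ p) {b} q n b≈0 = begin
    coeff ((a ∷ p) *ᴾ (b ∷ q)) (suc n)       ≈⟨ coeff-∷* a p (b ∷ q) (suc n) ⟩
    a * coeff q n + coeff (p *ᴾ (b ∷ q)) n   ≈⟨ +-congˡ (shift n) ⟩
    a * coeff q n + coeff (0# ∷ (p *ᴾ q)) n  ≈⟨ coeff-∷* a p q n ⟨
    coeff ((a ∷ p) *ᴾ q) n                   ∎
    where
    shift : ∀ n → coeff (p *ᴾ (b ∷ q)) n ≈ coeff (0# ∷ (p *ᴾ q)) n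
    shift zero    = coeff-*∷-zero p q b≈0
    shift (suc n) = coeff-*∷-suc p q n b≈0

  ∷-zero : ∀ {a p} → a ≈ 0# → p ≈ᴾ [] → a ∷ p ≈ᴾ []
  ∷-zero a≈0 p≈0 zero    = a≈0
  ∷-zero a≈0 p≈0 (suc n) = p≈0 n

  cancel : ∀ {x y} → x ≉ 0# → x * y ≈ 0# → y ≈ 0#
  cancel {x} {y} x≉0 xy≈0 = let x⁻¹ , xx⁻¹≈1 = inverse x x≉0 in begin
    y              ≈⟨ *-identityˡ y ⟨
    1# * y         ≈⟨ *-congʳ xx⁻¹≈1 ⟨
    x * x⁻¹ * y    ≈⟨ *-congʳ (*-comm x x⁻¹) ⟩
    x⁻¹ * x * y    ≈⟨ *-assoc x⁻¹ x y ⟩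
    x⁻¹ * (x * y)  ≈⟨ *-congˡ xy≈0 ⟩
    x⁻¹ * 0#       ≈⟨ zeroʳ x⁻¹ ⟩
    0#             ∎

  noZeroDivisors : ∀ p q → p *ᴾ q ≈ᴾ [] → p ≈ᴾ [] ⊎ q ≈ᴾ []
  noZeroDivisors []      _ _ = inj₁ λ _ → refl
  noZeroDivisors (a ∷ p) = go
    where
    go : ∀ q → (a ∷ p) *ᴾ q ≈ᴾ [] → a ∷ p ≈ᴾ [] ⊎ q ≈ᴾ []
    go []      _ = inj₂ λ _ → refl
    go (b ∷ q) pq≈0 with a ≟ 0#
    ... | yes a≈0 = Sum.map₁ (∷-zero a≈0) (noZeroDivisors p (b ∷ q) λ n → begin
      coeff (p *ᴾ (b ∷ q)) n                   ≈⟨ +-identityˡ _ ⟨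
      0# + coeff (p *ᴾ (b ∷ q)) n              ≈⟨ +-congʳ (zeroˡ _) ⟨
      0# * coeff q n + coeff (p *ᴾ (b ∷ q)) n  ≈⟨ +-congʳ (*-congʳ a≈0) ⟨
      a * coeff q n + coeff (p *ᴾ (b ∷ q)) n   ≈⟨ coeff-∷* a p (b ∷ q) (suc n) ⟨
      coeff ((a ∷ p) *ᴾ (b ∷ q)) (suc n)       ≈⟨ pq≈0 (suc n) ⟩
      0#                                       ∎)
    ... | no a≉0 = Sum.map₂ (∷-zero b≈0) (go q λ n →
      trans (sym (coeff-*∷-suc (a ∷ p) q n b≈0)) (pq≈0 (suc n)))
      where
      b≈0 : b ≈ 0#
      b≈0 = cancel a≉0 (trans (sym (+-identityʳ _)) (pq≈0 0))

  record RationalFunction : Set (c ⊔ ℓ₁) where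
    constructor fraction
    field
      num   : Poly
      den   : Poly
      den≉0 : ¬ (den ≈ᴾ [])

  open RationalFunction public

  polynomial : Poly → RationalFunction
  polynomial p = fraction p (1# ∷ []) λ 1≈0 →
    0≉1 (sym (1≈0 0))

  den*den≉0 : ∀ f g → ¬ (den f *ᴾ den g ≈ᴾ [])
  den*den≉0 f g eq = Sum.[ den≉0 f , den≉0 g ]′ (noZeroDivisors (den f) (den g) eq)

  rationalFunctions : RawRing (c ⊔ ℓ₁) ℓ₁
  rationalFunctions = record
    { Carrier = RationalFunction
    ; _≈_     = λ f g → num f *ᴾ den g ≈ᴾ num g *ᴾ den f
    ; _+_     = λ f g → fraction (num f *ᴾ den g +ᴾ num g *ᴾ den f)
                                 (den f *ᴾ den g) (den*den≉0 f g)
    ; _*_     = λ f g → fraction (num f *ᴾ num g)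
                                 (den f *ᴾ den g) (den*den≉0 f g)
    ; -_      = λ f → fraction (-ᴾ num f) (den f) (den≉0 f)
    ; 0#      = polynomial []
    ; 1#      = polynomial (1# ∷ [])
    }

  private
    module K = RawRing rationalFunctions
    module MK = Matrices rationalFunctions

  X : RationalFunction
  X = polynomial (0# ∷ 1# ∷ [])

  constant : Carrier → RationalFunction
  constant a = polynomial (a ∷ [])

  -- f has value y at x.  The fraction may be changed to one whose
  -- denominator does not vanish at x, so removable singularities of
  -- the given fraction do not matter.
  HasValue : RationalFunction → Carrier → Carrier → Set (c ⊔ ℓ₁)
  HasValue f x y = ∃[ g ] f K.≈ g
    × ¬ (evaluate (den g) x ≈ 0#)
    × evaluate (num g) x ≈ y * evaluate (den g) x

  -- χ = 𝟏ᵀ (X I - A)⁻¹ 𝟏, the inverse being that of a matrix over the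
  -- field of rational functions.
  IsCoronal : ∀ {n} → Matrix n → RationalFunction → Set (c ⊔ ℓ₁)
  IsCoronal {n} A χ = ∃[ B ]
      MK.IsInverse (MK.scalar X MK.-ᴹ λ i j → constant (A i j)) B
    × χ K.≈ MK.𝟏 MK.∙ᵥ (B MK.*ᵥ MK.𝟏)

  -- x is a root of X - n - n ν - n χ(X - n).  This rational function
  -- is defined at x precisely when χ is defined at x - n (for n ≠ 0).
  IsCoronalRoot : ℕ → Carrier → RationalFunction → Carrier → Set (c ⊔ ℓ₁)
  IsCoronalRoot n ν χ x = ∃[ y ] HasValue χ (x - fromℕ n) y
    × x - fromℕ n - fromℕ n * ν - fromℕ n * y ≈ 0#

{-# OPTIONS --safe #-}

-- On α over the vertices a_{ik} and β over the vertices b_{ik}, with N = n₂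
-- and row sums S i = Σₖ α i k, T i = Σₖ β i k, the eigenvalue equations of
-- the product read
--   (N r₁ + N) α i k + (A₁ S) i + T i = x α i k,
--   N β i k + (Q₂ β i) k + S i = x β i k.
-- If S = 0, then x = N r₁ + N or x - N is an eigenvalue of Q₂.  If S ≠ 0,
-- summing over k and using Q₂ 𝟏 = 2 r₂ 𝟏 gives (x - N - 2 r₂) T = N S, so that
-- either x = N + 2 r₂ or S is an eigenvector of Q₁ whose eigenvalue ν
-- satisfies x - N - N ν = N y with y = N / (x - N - 2 r₂).  Here y is
-- χ (x - N), because the coronal of an r₂-regular graph is N / (X - 2 r₂).
-- Conversely, eigenvectors of Q₂ orthogonal to 𝟏 and eigenvectors of Q₁
-- lift to eigenvectors of the product.
module Submission where

open import Defs
open import Algebra.Bundles using (CommutativeRing)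
open import Algebra.Bundles.Raw using (RawRing)
open import Data.Bool.Base using (true; false; if_then_else_; _∧_)
open import Data.Fin.Base using (Fin; zero; suc; _↑ˡ_; _↑ʳ_; join; splitAt; combine; remQuot; fromℕ<)
open import Data.Fin.Properties
  using (splitAt-join; join-splitAt; remQuot-combine; combine-remQuot; all?; ¬∀⟶∃¬)
  renaming (_≟_ to _≟ᶠ_)
open import Data.Integer.Base using (+_; -[1+_]; _⊖_)
open import Data.Integer.Properties using ([1+m]⊖[1+n]≡m⊖n)
open import Data.List.Base using ([]; _∷_; map)
open import Data.Nat.Base as ℕ using (ℕ; zero; suc; NonZero)
open import Data.Product.Base using (_×_; _,_; proj₁; proj₂; uncurry; ∃-syntax)
open import Data.Sum.Base as Sum using (inj₁; inj₂)
open import Data.Vec.Base using (count; tabulate)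
open import Data.Vec.Functional using (Vector)
open import Function.Base using (_∘_; id)
open import Function.Bundles using (_⇔_; mk⇔)
open import Relation.Binary.Definitions using (tri<; tri≈; tri>)
open import Relation.Binary.PropositionalEquality as ≡ using (_≡_)
open import Relation.Binary.Structures using (IsStrictTotalOrder)
open import Relation.Nullary.Decidable using (Dec; does; yes; no; does-⇔; dec-true)
open import Relation.Nullary.Negation using (¬_; contradiction)
open import Relation.Unary using (Pred; Decidable)

import Algebra.Properties.Ring as RingProperties
import Algebra.Properties.Semiring.Mult as Multiples
import Algebra.Properties.Semiring.Sum as Summation
import Algebra.Solver.Ring.NaturalCoefficients.Default as SemiringSolver
import Relation.Binary.Reasoning.Setoid as SetoidReasoning

-- `χ` is known only through some inverse `B` of `X I - Q₂` over fractions that are compared by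
-- cross-multiplication. No matrix identity applies to it before these fractions are known to form a
-- commutative ring, which is why polynomials and fractions are developed from their coefficients
-- up. After that `B` is never computed: every row of `X I - Q₂` has the same sum `X - 2 r₂`, and
-- this alone determines `𝟏ᵀ B 𝟏`.
--
-- The exceptional values are harmless because they are integers by themselves: `2 r₂`, whose
-- eigenvector `𝟏` is not orthogonal to `𝟏` and so does not lift from `G₂`, and `N + 2 r₂`, where
-- `χ (x - N)` has its pole.
--
-- That `S` is an eigenvector of `Q₁` is not yet enough: its eigenvalue has to be found in the given
-- list `ν`, and this comes from expanding `S` in the basis that accompanies `ν`. Every case
-- distinction, such as `S = 0` or not, is decided by the decidable equality of the field. Its order
-- gives characteristic zero, hence `N ≉ 0`.

-- Numbering of the vertices of the product.

module _ {n₁ n₂ : ℕ} where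

  -- The two-sided inverse of `⊛-vertex`. Matrix computations can thereby be stated at the vertices
  -- `a_{ik}` and `b_{ik}` instead of at bare numbers.
  index : ⊛-Vertex n₁ n₂ → Fin (n₁ ℕ.* n₂ ℕ.+ n₁ ℕ.* n₂)
  index u = join (n₁ ℕ.* n₂) (n₁ ℕ.* n₂) (Sum.map (uncurry combine) (uncurry combine) u)

  vertex-index : ∀ u → ⊛-vertex n₁ n₂ (index u) ≡ u
  vertex-index u = ≡.trans
    (≡.cong (Sum.map (remQuot n₂) (remQuot n₂))
      (splitAt-join (n₁ ℕ.* n₂) (n₁ ℕ.* n₂) (Sum.map (uncurry combine) (uncurry combine) u)))
    (remQuot-combine² u)
    where
    remQuot-combine² : ∀ u → Sum.map (remQuot n₂) (remQuot n₂)
                               (Sum.map (uncurry combine) (uncurry combine) u) ≡ u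
    remQuot-combine² (inj₁ (i , k)) = ≡.cong inj₁ (remQuot-combine i k)
    remQuot-combine² (inj₂ (i , k)) = ≡.cong inj₂ (remQuot-combine i k)

  index-vertex : ∀ x → index (⊛-vertex n₁ n₂ x) ≡ x
  index-vertex x = ≡.trans
    (≡.cong (join (n₁ ℕ.* n₂) (n₁ ℕ.* n₂)) (combine-remQuot² (splitAt (n₁ ℕ.* n₂) x)))
    (join-splitAt (n₁ ℕ.* n₂) (n₁ ℕ.* n₂) x)
    where
    combine-remQuot² : ∀ y → Sum.map (uncurry combine) (uncurry combine)
                               (Sum.map (remQuot {n₁} n₂) (remQuot {n₁} n₂) y) ≡ y
    combine-remQuot² (inj₁ y) = ≡.cong inj₁ (combine-remQuot {n₁} n₂ y)
    combine-remQuot² (inj₂ y) = ≡.cong inj₂ (combine-remQuot {n₁} n₂ y)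

-- Finite sums and matrices over a commutative ring.

module MatrixProperties {c ℓ} (R : CommutativeRing c ℓ) where
  open CommutativeRing R hiding (zero)
  open Matrices rawRing
  open SetoidReasoning setoid
  open RingProperties ring using (-0#≈0#; -‿+-comm)
  open Summation semiring public using (∑-distrib-+; ∑-comm)
    renaming (sum-cong-≋ to ∑-cong; *-distribˡ-sum to *-distribˡ-∑; *-distribʳ-sum to *-distribʳ-∑)
  open Summation semiring using (sum-replicate; sum-replicate-zero)
  open SemiringSolver commutativeSemiring using (solve; _:+_; _:*_; _:=_)

  ∑-zero : ∀ n → ∑ {n} 𝟎 ≈ 0#
  ∑-zero = sum-replicate-zero

  ∑-neg : ∀ {n} (f : Vector Carrier n) → ∑ (λ i → - f i) ≈ - ∑ f
  ∑-neg {zero}  f = sym -0#≈0#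
  ∑-neg {suc n} f = trans (+-congˡ (∑-neg (f ∘ suc))) (-‿+-comm _ _)

  ∑-const : ∀ n x → ∑ {n} (λ _ → x) ≈ fromℕ n * x
  ∑-const n x = begin
    ∑ {n} (λ _ → x)  ≈⟨ ∑-cong {n} (λ _ → *-identityˡ x) ⟨
    ∑ {n} (λ _ → 1# * x) ≈⟨ *-distribʳ-∑ {n} x 𝟏 ⟨
    ∑ {n} 𝟏 * x      ≈⟨ *-congʳ (sum-replicate n) ⟩
    fromℕ n * x      ∎

  if-* : ∀ b {x} y → (if b then x else 0#) * y ≈ (if b then x * y else 0#)
  if-* true  y = refl
  if-* false y = zeroˡ y

  ∑-if-≟ : ∀ {n} (i : Fin n) (f : Vector Carrier n) →
           ∑ (λ j → if does (i ≟ᶠ j) then f j else 0#) ≈ f i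
  ∑-if-≟ {suc n} zero    f = trans (+-congˡ (∑-zero n)) (+-identityʳ _)
  ∑-if-≟ {suc n} (suc i) f = trans (+-identityˡ _) (∑-if-≟ i (f ∘ suc))

  ∑-if : ∀ b {n} (f : Vector Carrier n) →
         ∑ (λ j → if b then f j else 0#) ≈ (if b then ∑ f else 0#)
  ∑-if true      f = refl
  ∑-if false {n} f = ∑-zero n

  if-∧ : ∀ b b′ {x : Carrier} → (if b ∧ b′ then x else 0#) ≡ (if b then (if b′ then x else 0#) else 0#)
  if-∧ true  b′ = ≡.refl
  if-∧ false b′ = ≡.refl

  *ᵥ-𝟏 : ∀ {n} (A : Matrix n) i → (A *ᵥ 𝟏) i ≈ ∑ (A i)
  *ᵥ-𝟏 A i = ∑-cong λ j → *-identityʳ (A i j)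

  *ᵥ-cong : ∀ {n} (A : Matrix n) {v w} → v ≈ᵥ w → A *ᵥ v ≈ᵥ A *ᵥ w
  *ᵥ-cong A v≈w i = ∑-cong λ j → *-congˡ (v≈w j)

  *ᵥ-≈𝟎 : ∀ {n} (A : Matrix n) {v} → v ≈ᵥ 𝟎 → A *ᵥ v ≈ᵥ 𝟎
  *ᵥ-≈𝟎 {n} A v≈0 i = trans (∑-cong λ j → trans (*-congˡ (v≈0 j)) (zeroʳ (A i j))) (∑-zero n)

  *ᵥ-·ᵥ : ∀ {n} (A : Matrix n) a v → A *ᵥ (a ·ᵥ v) ≈ᵥ a ·ᵥ (A *ᵥ v)
  *ᵥ-·ᵥ A a v i = begin
    ∑ (λ j → A i j * (a * v j))
      ≈⟨ ∑-cong (λ j → solve 3 (λ p q r → p :* (q :* r) := q :* (p :* r)) refl (A i j) a (v j)) ⟩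
    ∑ (λ j → a * (A i j * v j))  ≈⟨ *-distribˡ-∑ a (λ j → A i j * v j) ⟨
    a * (A *ᵥ v) i               ∎

  *ᵥ-∑ : ∀ {m n} (A : Matrix n) (v : Fin m → Vector Carrier n) i →
         (A *ᵥ (λ j → ∑ λ k → v k j)) i ≈ ∑ λ k → (A *ᵥ v k) i
  *ᵥ-∑ A v i = begin
    ∑ (λ j → A i j * ∑ λ k → v k j)    ≈⟨ ∑-cong (λ j → *-distribˡ-∑ (A i j) λ k → v k j) ⟩
    ∑ (λ j → ∑ λ k → A i j * v k j)    ≈⟨ ∑-comm (λ j k → A i j * v k j) ⟩
    ∑ (λ k → (A *ᵥ v k) i)             ∎

  *ᴹ-*ᵥ-assoc : ∀ {n} (A B : Matrix n) v → (A *ᴹ B) *ᵥ v ≈ᵥ A *ᵥ (B *ᵥ v)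
  *ᴹ-*ᵥ-assoc A B v i = begin
    ∑ (λ j → ∑ (λ k → A i k * B k j) * v j)
      ≈⟨ ∑-cong (λ j → trans (*-distribʳ-∑ (v j) λ k → A i k * B k j)
                        (∑-cong λ k → *-assoc (A i k) (B k j) (v j))) ⟩
    ∑ (λ j → ∑ (λ k → A i k * (B k j * v j)))    ≈⟨ *ᵥ-∑ A (λ j k → B k j * v j) i ⟨
    ∑ (λ k → A i k * ∑ (λ j → B k j * v j))      ∎

  diagonal-*ᵥ : ∀ {n} (d v : Vector Carrier n) i → (diagonal d *ᵥ v) i ≈ d i * v i
  diagonal-*ᵥ d v i = trans (∑-cong λ j → if-* (does (i ≟ᶠ j)) (v j)) (∑-if-≟ i λ j → d i * v j)

  +ᴹ-*ᵥ : ∀ {n} (A B : Matrix n) v i → ((A +ᴹ B) *ᵥ v) i ≈ (A *ᵥ v) i + (B *ᵥ v) i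
  +ᴹ-*ᵥ A B v i = trans (∑-cong λ j → distribʳ (v j) (A i j) (B i j)) (∑-distrib-+ (λ j → A i j * v j) _)

  scalar-ᴹ-*ᵥ-𝟏 : ∀ {n} x (A : Matrix n) i → ((scalar x -ᴹ A) *ᵥ 𝟏) i ≈ x - ∑ (A i)
  scalar-ᴹ-*ᵥ-𝟏 {n} x A i = begin
    ((scalar x -ᴹ A) *ᵥ 𝟏) i                    ≈⟨ +ᴹ-*ᵥ (scalar x) (λ i j → - A i j) 𝟏 i ⟩
    (scalar x *ᵥ 𝟏) i + ((λ i j → - A i j) *ᵥ 𝟏) i
      ≈⟨ +-cong (diagonal-*ᵥ (λ _ → x) 𝟏 i) (*ᵥ-𝟏 (λ i j → - A i j) i) ⟩
    x * 1# + ∑ (λ j → - A i j)                  ≈⟨ +-cong (*-identityʳ x) (∑-neg (A i)) ⟩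
    x - ∑ (A i)                                 ∎

  -- Applying `B` to `A 𝟏 = d 𝟏` gives `𝟏 = d (B 𝟏)`; then add up the entries. Keeping `d` as a
  -- factor avoids dividing by it, so that any commutative ring will do.
  rowSum-*-𝟏ᵀA⁻¹𝟏 : ∀ {n} {A B : Matrix n} {d} → IsInverse A B → (∀ i → (A *ᵥ 𝟏) i ≈ d) →
                d * (𝟏 ∙ᵥ (B *ᵥ 𝟏)) ≈ ∑ {n} 𝟏
  rowSum-*-𝟏ᵀA⁻¹𝟏 {n} {A} {B} {d} (_ , BA≈1) A𝟏≈d = begin
    d * ∑ (λ i → 1# * (B *ᵥ 𝟏) i)    ≈⟨ *-distribˡ-∑ d (λ i → 1# * (B *ᵥ 𝟏) i) ⟩
    ∑ (λ i → d * (1# * (B *ᵥ 𝟏) i))  ≈⟨ ∑-cong row ⟩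
    ∑ {n} 𝟏                         ∎
    where
    row : ∀ i → d * (1# * (B *ᵥ 𝟏) i) ≈ 1#
    row i = begin
      d * (1# * (B *ᵥ 𝟏) i)   ≈⟨ *-congˡ (*-identityˡ _) ⟩
      d * (B *ᵥ 𝟏) i          ≈⟨ *ᵥ-·ᵥ B d 𝟏 i ⟨
      (B *ᵥ (d ·ᵥ 𝟏)) i       ≈⟨ *ᵥ-cong B (λ j → trans (A𝟏≈d j) (sym (*-identityʳ d))) i ⟨
      (B *ᵥ (A *ᵥ 𝟏)) i       ≈⟨ *ᴹ-*ᵥ-assoc B A 𝟏 i ⟨
      ((B *ᴹ A) *ᵥ 𝟏) i       ≈⟨ ∑-cong (λ j → *-congʳ (BA≈1 i j)) ⟩
      (scalar 1# *ᵥ 𝟏) i      ≈⟨ diagonal-*ᵥ (λ _ → 1#) 𝟏 i ⟩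
      1# * 1#                 ≈⟨ *-identityˡ 1# ⟩
      1#                      ∎

  -- The signless Laplacian of a regular graph.

  -- `allFin` is `tabulate id`; a general `f` is what the induction needs, since each step
  -- precomposes with `suc`.
  count-≈ : ∀ {p} {A : Set} {P : Pred A p} (P? : Decidable P) {n} (f : Fin n → A) →
            fromℕ (count P? (tabulate f)) ≈ ∑ λ j → if does (P? (f j)) then 1# else 0#
  count-≈ P? {zero}  f = refl
  count-≈ P? {suc n} f with does (P? (f zero))
  ... | true  = +-congˡ (count-≈ P? (f ∘ suc))
  ... | false = trans (count-≈ P? (f ∘ suc)) (sym (+-identityˡ _))

  -- Degrees become entries of `A 𝟏`. The degrees in the product then follow from the block formulas
  -- for its adjacency matrix, with no separate count of neighbours.
  degree-≈ : ∀ {n} (G : Graph n) i → fromℕ (Graph.degree G i) ≈ (adjacencyMatrix G *ᵥ 𝟏) i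
  degree-≈ G i = trans (count-≈ (i ~?_) id) (sym (*ᵥ-𝟏 (adjacencyMatrix G) i))
    where open Graph G

  signlessLaplacian-*ᵥ : ∀ {n} (G : Graph n) v i → (signlessLaplacian G *ᵥ v) i
                         ≈ fromℕ (Graph.degree G i) * v i + (adjacencyMatrix G *ᵥ v) i
  signlessLaplacian-*ᵥ G v i = trans (+ᴹ-*ᵥ (degreeMatrix G) (adjacencyMatrix G) v i)
    (+-congʳ (diagonal-*ᵥ (λ j → fromℕ (Graph.degree G j)) v i))

  adjacencyMatrix-sym : ∀ {n} (G : Graph n) i j → adjacencyMatrix G i j ≡ adjacencyMatrix G j i
  adjacencyMatrix-sym G i j = ≡.cong (if_then 1# else 0#) (does-⇔ (mk⇔ ~-sym ~-sym) (i ~? j) (j ~? i))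
    where open Graph G

  module _ {n r} (G : Graph n) (regular : Regular r G) where
    private
      A = adjacencyMatrix G

    regular-∑-row : ∀ i → ∑ (A i) ≈ fromℕ r
    regular-∑-row i = begin
      ∑ (A i)                   ≈⟨ *ᵥ-𝟏 A i ⟨
      (A *ᵥ 𝟏) i                ≈⟨ degree-≈ G i ⟨
      fromℕ (Graph.degree G i)  ≡⟨ ≡.cong fromℕ (regular i) ⟩
      fromℕ r                   ∎

    regular-*ᵥ : ∀ v i → (signlessLaplacian G *ᵥ v) i ≈ fromℕ r * v i + (A *ᵥ v) i
    regular-*ᵥ v i = trans (signlessLaplacian-*ᵥ G v i)
      (+-congʳ (*-congʳ (reflexive (≡.cong fromℕ (regular i)))))

    regular-*ᵥ-const : ∀ x i → (signlessLaplacian G *ᵥ (λ _ → x)) i ≈ (fromℕ r + fromℕ r) * x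
    regular-*ᵥ-const x i = begin
      (signlessLaplacian G *ᵥ (λ _ → x)) i     ≈⟨ regular-*ᵥ (λ _ → x) i ⟩
      fromℕ r * x + (A *ᵥ (λ _ → x)) i         ≈⟨ +-congˡ (*-distribʳ-∑ x (A i)) ⟨
      fromℕ r * x + ∑ (A i) * x                ≈⟨ +-congˡ (*-congʳ (regular-∑-row i)) ⟩
      fromℕ r * x + fromℕ r * x                ≈⟨ distribʳ x (fromℕ r) (fromℕ r) ⟨
      (fromℕ r + fromℕ r) * x                  ∎

    -- By symmetry of `A` its column sums are its row sums, so `𝟏ᵀ Q = 2 r 𝟏ᵀ`: the all-ones vector
    -- is a left eigenvector too.
    regular-∑-*ᵥ : ∀ v → ∑ (signlessLaplacian G *ᵥ v) ≈ (fromℕ r + fromℕ r) * ∑ v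
    regular-∑-*ᵥ v = begin
      ∑ (signlessLaplacian G *ᵥ v)                          ≈⟨ ∑-cong (regular-*ᵥ v) ⟩
      ∑ (λ i → fromℕ r * v i + (A *ᵥ v) i)
        ≈⟨ ∑-distrib-+ (λ i → fromℕ r * v i) (A *ᵥ v) ⟩
      ∑ (λ i → fromℕ r * v i) + ∑ (A *ᵥ v)
        ≈⟨ +-cong (sym (*-distribˡ-∑ (fromℕ r) v)) (∑-comm (λ i j → A i j * v j)) ⟩
      fromℕ r * ∑ v + ∑ (λ j → ∑ (λ i → A i j * v j))
        ≈⟨ +-congˡ (∑-cong λ j → *-distribʳ-∑ (v j) (λ i → A i j)) ⟨
      fromℕ r * ∑ v + ∑ (λ j → ∑ (λ i → A i j) * v j)
        ≈⟨ +-congˡ (∑-cong λ j → *-congʳ (trans (∑-cong λ i → reflexive (adjacencyMatrix-sym G i j)) (regular-∑-row j))) ⟩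
      fromℕ r * ∑ v + ∑ (λ j → fromℕ r * v j)               ≈⟨ +-congˡ (*-distribˡ-∑ (fromℕ r) v) ⟨
      fromℕ r * ∑ v + fromℕ r * ∑ v                         ≈⟨ distribʳ (∑ v) (fromℕ r) (fromℕ r) ⟨
      (fromℕ r + fromℕ r) * ∑ v                             ∎

  -- Block form of the matrix of the product.

  ∑-↑ : ∀ m {n} (f : Vector Carrier (m ℕ.+ n)) → ∑ f ≈ ∑ (λ i → f (i ↑ˡ n)) + ∑ (λ j → f (m ↑ʳ j))
  ∑-↑ zero    f = sym (+-identityˡ _)
  ∑-↑ (suc m) f = trans (+-congˡ (∑-↑ m (f ∘ suc))) (sym (+-assoc _ _ _))

  ∑-combine : ∀ m {n} (f : Vector Carrier (m ℕ.* n)) → ∑ f ≈ ∑ λ i → ∑ λ k → f (combine {m} i k)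
  ∑-combine zero        f = refl
  ∑-combine (suc m) {n} f = trans (∑-↑ n f) (+-congˡ (∑-combine m (f ∘ (n ↑ʳ_))))

  ∑-index : ∀ {n₁ n₂} (f : Vector Carrier (n₁ ℕ.* n₂ ℕ.+ n₁ ℕ.* n₂)) →
            ∑ f ≈ ∑ (λ i → ∑ λ k → f (index {n₁} (inj₁ (i , k)))) + ∑ (λ i → ∑ λ k → f (index {n₁} (inj₂ (i , k))))
  ∑-index {n₁} {n₂} f = trans (∑-↑ (n₁ ℕ.* n₂) f)
    (+-cong (∑-combine n₁ (f ∘ (_↑ˡ _))) (∑-combine n₁ (f ∘ ((n₁ ℕ.* n₂) ↑ʳ_))))

  module Product {n₁ n₂} (G₁ : Graph n₁) (G₂ : Graph n₂) where
    private
      A₁ = adjacencyMatrix G₁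
      A₂ = adjacencyMatrix G₂
      A  = adjacencyMatrix (G₁ ⊛ G₂)

      entry : ⊛-Vertex n₁ n₂ → ⊛-Vertex n₁ n₂ → Carrier
      entry u w = if does (⊛-adjacent? G₁ G₂ u w) then 1# else 0#

      A-index : ∀ u w → A (index u) (index w) ≡ entry u w
      A-index u w = ≡.cong₂ entry (vertex-index u) (vertex-index w)

    module _ (v : Vector Carrier (n₁ ℕ.* n₂ ℕ.+ n₁ ℕ.* n₂)) (α β : Fin n₁ → Vector Carrier n₂)
             (v-α : ∀ i k → v (index (inj₁ (i , k))) ≈ α i k)
             (v-β : ∀ i k → v (index (inj₂ (i , k))) ≈ β i k) where

      -- The blocks `α` and `β` are tied to `v` only by pointwise equations. The same formulas then
      -- serve to read blocks off a given eigenvector and to assemble an eigenvector from given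
      -- blocks.
      adjacency-*ᵥ-index : ∀ u → (A *ᵥ v) (index u) ≈
                           ∑ (λ i → ∑ λ k → entry u (inj₁ (i , k)) * α i k)
                           + ∑ (λ i → ∑ λ k → entry u (inj₂ (i , k)) * β i k)
      adjacency-*ᵥ-index u = trans (∑-index {n₁} (λ x → A (index u) x * v x))
        (+-cong (∑-cong λ i → ∑-cong λ k → *-cong (reflexive (A-index u (inj₁ (i , k)))) (v-α i k))
                (∑-cong λ i → ∑-cong λ k → *-cong (reflexive (A-index u (inj₂ (i , k)))) (v-β i k)))

      private
        ∑-if-≟-* : ∀ i (w : Fin n₁ → Vector Carrier n₂) →
                 ∑ (λ j → ∑ λ k → (if does (i ≟ᶠ j) then 1# else 0#) * w j k) ≈ ∑ (w i)
        ∑-if-≟-* i w = begin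
          ∑ (λ j → ∑ λ k → δ j * w j k)             ≈⟨ ∑-cong (λ j → *-distribˡ-∑ (δ j) (w j)) ⟨
          ∑ (λ j → δ j * ∑ (w j))
            ≈⟨ ∑-cong (λ j → if-* (does (i ≟ᶠ j)) (∑ (w j))) ⟩
          ∑ (λ j → if does (i ≟ᶠ j) then 1# * ∑ (w j) else 0#) ≈⟨ ∑-if-≟ i (λ j → 1# * ∑ (w j)) ⟩
          1# * ∑ (w i)                              ≈⟨ *-identityˡ _ ⟩
          ∑ (w i)                                   ∎
          where δ = λ j → if does (i ≟ᶠ j) then 1# else 0#

      -- With `J` the all-ones matrix, the block between `a`-vertices is `A₁ ⊗ J` and the mixed
      -- block is `I ⊗ J`. Both see only the row sums of `α` and `β`, so the result does not depend
      -- on `k`.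
      adjacency-*ᵥ-a : ∀ i k → (A *ᵥ v) (index (inj₁ (i , k))) ≈ (A₁ *ᵥ (λ j → ∑ (α j))) i + ∑ (β i)
      adjacency-*ᵥ-a i k = trans (adjacency-*ᵥ-index (inj₁ (i , k)))
        (+-cong (∑-cong λ j → sym (*-distribˡ-∑ (A₁ i j) (α j))) (∑-if-≟-* i β))

      -- The block between `b`-vertices is `I ⊗ A₂`: the test for equal first components selects the
      -- single copy `β i`.
      adjacency-*ᵥ-b : ∀ i k → (A *ᵥ v) (index (inj₂ (i , k))) ≈ ∑ (α i) + (A₂ *ᵥ β i) k
      adjacency-*ᵥ-b i k = trans (adjacency-*ᵥ-index (inj₂ (i , k))) (+-cong (∑-if-≟-* i α) (begin
        ∑ (λ j → ∑ λ l → entry (inj₂ (i , k)) (inj₂ (j , l)) * β j l)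
          ≈⟨ ∑-cong (λ j → trans (∑-cong λ l → trans
               (*-congʳ (reflexive (if-∧ (does (i ≟ᶠ j)) (does (Graph._~?_ G₂ k l)))))
               (if-* (does (i ≟ᶠ j)) (β j l))) (∑-if (does (i ≟ᶠ j)) λ l → A₂ k l * β j l)) ⟩
        ∑ (λ j → if does (i ≟ᶠ j) then (A₂ *ᵥ β j) k else 0#)
          ≈⟨ ∑-if-≟ i (λ j → (A₂ *ᵥ β j) k) ⟩
        (A₂ *ᵥ β i) k ∎))

    module _ {r₁ r₂} (reg₁ : Regular r₁ G₁) (reg₂ : Regular r₂ G₂) where

      private
        degree-a : ∀ i k → fromℕ (Graph.degree (G₁ ⊛ G₂) (index (inj₁ (i , k)))) ≈ fromℕ n₂ * fromℕ r₁ + fromℕ n₂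
        degree-a i k = begin
          fromℕ (Graph.degree (G₁ ⊛ G₂) (index (inj₁ (i , k))))
            ≈⟨ degree-≈ (G₁ ⊛ G₂) (index (inj₁ (i , k))) ⟩
          (A *ᵥ 𝟏) (index (inj₁ (i , k)))
            ≈⟨ adjacency-*ᵥ-a 𝟏 (λ _ → 𝟏) (λ _ → 𝟏) (λ _ _ → refl) (λ _ _ → refl) i k ⟩
          (A₁ *ᵥ (λ _ → ∑ {n₂} 𝟏)) i + ∑ {n₂} 𝟏
            ≈⟨ +-cong (trans (sym (*-distribʳ-∑ (∑ {n₂} 𝟏) (A₁ i))) (*-cong (regular-∑-row G₁ reg₁ i) ∑𝟏)) ∑𝟏 ⟩
          fromℕ r₁ * fromℕ n₂ + fromℕ n₂                         ≈⟨ +-congʳ (*-comm _ _) ⟩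
          fromℕ n₂ * fromℕ r₁ + fromℕ n₂                         ∎
          where ∑𝟏 = sum-replicate n₂

        degree-b : ∀ i k → fromℕ (Graph.degree (G₁ ⊛ G₂) (index (inj₂ (i , k)))) ≈ fromℕ n₂ + fromℕ r₂
        degree-b i k = begin
          fromℕ (Graph.degree (G₁ ⊛ G₂) (index (inj₂ (i , k))))
            ≈⟨ degree-≈ (G₁ ⊛ G₂) (index (inj₂ (i , k))) ⟩
          (A *ᵥ 𝟏) (index (inj₂ (i , k)))
            ≈⟨ adjacency-*ᵥ-b 𝟏 (λ _ → 𝟏) (λ _ → 𝟏) (λ _ _ → refl) (λ _ _ → refl) i k ⟩
          ∑ {n₂} 𝟏 + (A₂ *ᵥ 𝟏) k
            ≈⟨ +-cong (sum-replicate n₂) (trans (*ᵥ-𝟏 A₂ k) (regular-∑-row G₂ reg₂ k)) ⟩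
          fromℕ n₂ + fromℕ r₂                                    ∎

      module _ (v : Vector Carrier (n₁ ℕ.* n₂ ℕ.+ n₁ ℕ.* n₂)) (α β : Fin n₁ → Vector Carrier n₂)
               (v-α : ∀ i k → v (index (inj₁ (i , k))) ≈ α i k)
               (v-β : ∀ i k → v (index (inj₂ (i , k))) ≈ β i k) where

        ⊛-*ᵥ-a : ∀ i k → (signlessLaplacian (G₁ ⊛ G₂) *ᵥ v) (index (inj₁ (i , k)))
                 ≈ (fromℕ n₂ * fromℕ r₁ + fromℕ n₂) * α i k + (A₁ *ᵥ (λ j → ∑ (α j))) i + ∑ (β i)
        ⊛-*ᵥ-a i k = trans (signlessLaplacian-*ᵥ (G₁ ⊛ G₂) v (index (inj₁ (i , k)))) (trans
          (+-cong (*-cong (degree-a i k) (v-α i k)) (adjacency-*ᵥ-a v α β v-α v-β i k))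
          (sym (+-assoc _ _ _)))

        -- The degree `N + r₂` of `b_{ik}` contains `r₂` exactly once, so it combines with `A₂` into
        -- `Q₂`. At `a_{ik}` the term `N r₁` multiplies `α i k` while `A₁` acts on the sums, and
        -- `Q₁` can appear only after summation over `k`.
        ⊛-*ᵥ-b : ∀ i k → (signlessLaplacian (G₁ ⊛ G₂) *ᵥ v) (index (inj₂ (i , k)))
                 ≈ fromℕ n₂ * β i k + (signlessLaplacian G₂ *ᵥ β i) k + ∑ (α i)
        ⊛-*ᵥ-b i k = begin
          (signlessLaplacian (G₁ ⊛ G₂) *ᵥ v) (index (inj₂ (i , k)))
            ≈⟨ signlessLaplacian-*ᵥ (G₁ ⊛ G₂) v (index (inj₂ (i , k))) ⟩
          fromℕ (Graph.degree (G₁ ⊛ G₂) (index (inj₂ (i , k)))) * v (index (inj₂ (i , k))) + (A *ᵥ v) (index (inj₂ (i , k)))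
            ≈⟨ +-cong (*-cong (degree-b i k) (v-β i k)) (adjacency-*ᵥ-b v α β v-α v-β i k) ⟩
          (fromℕ n₂ + fromℕ r₂) * β i k + (∑ (α i) + (A₂ *ᵥ β i) k)
            ≈⟨ solve 5 (λ n r b s t → (n :+ r) :* b :+ (s :+ t) := n :* b :+ (r :* b :+ t) :+ s) refl
                 (fromℕ n₂) (fromℕ r₂) (β i k) (∑ (α i)) ((A₂ *ᵥ β i) k) ⟩
          fromℕ n₂ * β i k + (fromℕ r₂ * β i k + (A₂ *ᵥ β i) k) + ∑ (α i)
            ≈⟨ +-congʳ (+-congˡ (regular-*ᵥ G₂ reg₂ (β i) k)) ⟨
          fromℕ n₂ * β i k + (signlessLaplacian G₂ *ᵥ β i) k + ∑ (α i) ∎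

-- Cross-multiplied identities of fractions.

module FractionArithmetic {c ℓ} (R : CommutativeRing c ℓ) where
  open CommutativeRing R
  open SetoidReasoning setoid
  open RingProperties ring using (-‿distribˡ-*)
  open SemiringSolver commutativeSemiring using (solve; con; _:+_; _:*_; _:=_)

  cross-+-cong : ∀ n d n′ d′ m e m′ e′ → n * d′ ≈ n′ * d → m * e′ ≈ m′ * e →
                 (n * e + m * d) * (d′ * e′) ≈ (n′ * e′ + m′ * d′) * (d * e)
  cross-+-cong n d n′ d′ m e m′ e′ p q = begin
    (n * e + m * d) * (d′ * e′)
      ≈⟨ solve 6 (λ n d d′ m e e′ → (n :* e :+ m :* d) :* (d′ :* e′)
           := (n :* d′) :* (e :* e′) :+ (m :* e′) :* (d :* d′))
           refl n d d′ m e e′ ⟩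
    n * d′ * (e * e′) + m * e′ * (d * d′)
      ≈⟨ +-cong (*-congʳ p) (*-congʳ q) ⟩
    n′ * d * (e * e′) + m′ * e * (d * d′)
      ≈⟨ solve 6 (λ n′ d d′ m′ e e′ → n′ :* d :* (e :* e′) :+ m′ :* e :* (d :* d′)
           := (n′ :* e′ :+ m′ :* d′) :* (d :* e))
           refl n′ d d′ m′ e e′ ⟩
    (n′ * e′ + m′ * d′) * (d * e) ∎

  cross-*-cong : ∀ n d n′ d′ m e m′ e′ → n * d′ ≈ n′ * d → m * e′ ≈ m′ * e →
                 (n * m) * (d′ * e′) ≈ (n′ * m′) * (d * e)
  cross-*-cong n d n′ d′ m e m′ e′ p q = begin
    (n * m) * (d′ * e′)      ≈⟨ interchange n m d′ e′ ⟩
    (n * d′) * (m * e′)      ≈⟨ *-cong p q ⟩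
    (n′ * d) * (m′ * e)      ≈⟨ interchange n′ d m′ e ⟩
    (n′ * m′) * (d * e)      ∎
    where
    interchange : ∀ a b c d → (a * b) * (c * d) ≈ (a * c) * (b * d)
    interchange = solve 4 (λ a b c d → (a :* b) :* (c :* d) := (a :* c) :* (b :* d)) refl

  cross-neg-cong : ∀ n d n′ d′ → n * d′ ≈ n′ * d → - n * d′ ≈ - n′ * d
  cross-neg-cong n d n′ d′ p = trans (sym (-‿distribˡ-* n d′)) (trans (-‿cong p) (-‿distribˡ-* n′ d))

  cross-+-assoc : ∀ n d m e l f →
    ((n * e + m * d) * f + l * (d * e)) * (d * (e * f)) ≈ (n * (e * f) + (m * f + l * e) * d) * (d * e * f)
  cross-+-assoc = solve 6 (λ n d m e l f →
    ((n :* e :+ m :* d) :* f :+ l :* (d :* e)) :* (d :* (e :* f)) := (n :* (e :* f) :+ (m :* f :+ l :* e) :* d) :* (d :* e :* f)) refl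

  cross-+-comm : ∀ n d m e → (n * e + m * d) * (e * d) ≈ (m * d + n * e) * (d * e)
  cross-+-comm = solve 4 (λ n d m e → (n :* e :+ m :* d) :* (e :* d) := (m :* d :+ n :* e) :* (d :* e)) refl

  cross-+-identityˡ : ∀ n d → (0# * d + n * 1#) * d ≈ n * (1# * d)
  cross-+-identityˡ = solve 2 (λ n d → (con 0 :* d :+ n :* con 1) :* d := n :* (con 1 :* d)) refl

  cross-inverseˡ : ∀ n d → (- n * d + n * d) * 1# ≈ 0# * (d * d)
  cross-inverseˡ n d = begin
    (- n * d + n * d) * 1#  ≈⟨ *-identityʳ _ ⟩
    - n * d + n * d         ≈⟨ distribʳ d (- n) n ⟨
    (- n + n) * d           ≈⟨ *-congʳ (-‿inverseˡ n) ⟩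
    0# * d                  ≈⟨ zeroˡ d ⟩
    0#                      ≈⟨ zeroˡ (d * d) ⟨
    0# * (d * d)            ∎

  cross-*-assoc : ∀ n d m e l f → (n * m * l) * (d * (e * f)) ≈ (n * (m * l)) * (d * e * f)
  cross-*-assoc = solve 6 (λ n d m e l f → (n :* m :* l) :* (d :* (e :* f)) := (n :* (m :* l)) :* (d :* e :* f)) refl

  cross-*-comm : ∀ n d m e → (n * m) * (e * d) ≈ (m * n) * (d * e)
  cross-*-comm = solve 4 (λ n d m e → (n :* m) :* (e :* d) := (m :* n) :* (d :* e)) refl

  cross-*-identityˡ : ∀ n d → (1# * n) * d ≈ n * (1# * d)
  cross-*-identityˡ = solve 2 (λ n d → (con 1 :* n) :* d := n :* (con 1 :* d)) refl

  cross-distribˡ : ∀ n d m e l f →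
    (n * (m * f + l * e)) * (d * e * (d * f)) ≈ (n * m * (d * f) + n * l * (d * e)) * (d * (e * f))
  cross-distribˡ = solve 6 (λ n d m e l f →
    (n :* (m :* f :+ l :* e)) :* (d :* e :* (d :* f)) := (n :* m :* (d :* f) :+ n :* l :* (d :* e)) :* (d :* (e :* f))) refl

  -- A cross product cannot be divided by the middle denominator e, so
  -- transitivity rests on the absence of zero divisors.
  cross-trans : (∀ x y → x * y ≈ 0# → ¬ (y ≈ 0#) → x ≈ 0#) →
                ∀ n d m e l f → ¬ (e ≈ 0#) → n * e ≈ m * d → m * f ≈ l * e → n * f ≈ l * d
  cross-trans noZeroDivisors n d m e l f e≉0 p q = begin
    n * f                      ≈⟨ +-identityʳ _ ⟨
    n * f + 0#                 ≈⟨ +-congˡ (-‿inverseˡ (l * d)) ⟨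
    n * f + (- (l * d) + l * d) ≈⟨ +-assoc _ _ _ ⟨
    n * f + - (l * d) + l * d  ≈⟨ +-congʳ (noZeroDivisors (n * f + - (l * d)) e difference*e e≉0) ⟩
    0# + l * d                 ≈⟨ +-identityˡ _ ⟩
    l * d                      ∎
    where
    difference*e : (n * f + - (l * d)) * e ≈ 0#
    difference*e = begin
      (n * f + - (l * d)) * e            ≈⟨ distribʳ e (n * f) (- (l * d)) ⟩
      n * f * e + - (l * d) * e
        ≈⟨ +-cong (solve 3 (λ n f e → n :* f :* e := n :* e :* f)
             refl n f e) (sym (-‿distribˡ-* (l * d) e)) ⟩
      n * e * f + - (l * d * e)
        ≈⟨ +-cong (*-congʳ p) (-‿cong (begin
          l * d * e  ≈⟨ solve 3 (λ l d e → l :* d :* e := l :* e :* d) refl l d e ⟩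
          l * e * d  ≈⟨ *-congʳ q ⟨
          m * f * d  ≈⟨ solve 3 (λ m f d → m :* f :* d := m :* d :* f) refl m f d ⟩
          m * d * f  ∎)) ⟩
      m * d * f + - (m * d * f)          ≈⟨ -‿inverseʳ _ ⟩
      0#                                 ∎

-- The rings of polynomials and of rational functions.

module RationalFunctionProperties {c ℓ₁ ℓ₂} (F : RealClosedField c ℓ₁ ℓ₂) where
  open RealClosedField F hiding (zero)
  open Over F
  open SetoidReasoning setoid
  open RingProperties ring using (-0#≈0#)
  open SemiringSolver commutativeSemiring using (solve; con; _:+_; _:*_; _:=_)

  +ᴾ-cong : ∀ p p′ q q′ → p ≈ᴾ p′ → q ≈ᴾ q′ → p +ᴾ q ≈ᴾ p′ +ᴾ q′
  +ᴾ-cong p p′ q q′ p≈p′ q≈q′ n = begin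
    coeff (p +ᴾ q) n        ≈⟨ coeff-+ p q n ⟩
    coeff p n + coeff q n   ≈⟨ +-cong (p≈p′ n) (q≈q′ n) ⟩
    coeff p′ n + coeff q′ n ≈⟨ coeff-+ p′ q′ n ⟨
    coeff (p′ +ᴾ q′) n      ∎

  +ᴾ-assoc : ∀ p q r → (p +ᴾ q) +ᴾ r ≈ᴾ p +ᴾ (q +ᴾ r)
  +ᴾ-assoc p q r n = begin
    coeff ((p +ᴾ q) +ᴾ r) n              ≈⟨ trans (coeff-+ (p +ᴾ q) r n) (+-congʳ (coeff-+ p q n)) ⟩
    coeff p n + coeff q n + coeff r n    ≈⟨ +-assoc _ _ _ ⟩
    coeff p n + (coeff q n + coeff r n)  ≈⟨ trans (coeff-+ p (q +ᴾ r) n) (+-congˡ (coeff-+ q r n)) ⟨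
    coeff (p +ᴾ (q +ᴾ r)) n              ∎

  +ᴾ-comm : ∀ p q → p +ᴾ q ≈ᴾ q +ᴾ p
  +ᴾ-comm p q n = trans (coeff-+ p q n) (trans (+-comm _ _) (sym (coeff-+ q p n)))

  +ᴾ-identityʳ : ∀ p → p +ᴾ [] ≈ᴾ p
  +ᴾ-identityʳ []      n = refl
  +ᴾ-identityʳ (a ∷ p) n = refl

  coeff-neg : ∀ p n → coeff (-ᴾ p) n ≈ - coeff p n
  coeff-neg []      n       = sym -0#≈0#
  coeff-neg (a ∷ p) zero    = refl
  coeff-neg (a ∷ p) (suc n) = coeff-neg p n

  -ᴾ-inverseˡ : ∀ p → (-ᴾ p) +ᴾ p ≈ᴾ []
  -ᴾ-inverseˡ p n = trans (coeff-+ (-ᴾ p) p n) (trans (+-congʳ (coeff-neg p n)) (-‿inverseˡ _))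

  ∷-cong : ∀ {a b p q} → a ≈ b → p ≈ᴾ q → (a ∷ p) ≈ᴾ (b ∷ q)
  ∷-cong a≈b p≈q zero    = a≈b
  ∷-cong a≈b p≈q (suc n) = p≈q n

  *ᴾ-congˡ : ∀ p q q′ → q ≈ᴾ q′ → p *ᴾ q ≈ᴾ p *ᴾ q′
  *ᴾ-congˡ []      q q′ q≈q′ n = refl
  *ᴾ-congˡ (a ∷ p) q q′ q≈q′ n = begin
    coeff ((a ∷ p) *ᴾ q) n                    ≈⟨ coeff-∷* a p q n ⟩
    a * coeff q n + coeff (0# ∷ (p *ᴾ q)) n
      ≈⟨ +-cong (*-congˡ (q≈q′ n)) (∷-cong {p = p *ᴾ q} refl (*ᴾ-congˡ p q q′ q≈q′) n) ⟩
    a * coeff q′ n + coeff (0# ∷ (p *ᴾ q′)) n ≈⟨ coeff-∷* a p q′ n ⟨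
    coeff ((a ∷ p) *ᴾ q′) n                   ∎

  -- Multiplication recurses on its left factor; this is the matching expansion along the right
  -- factor, and comparing the two yields commutativity.
  coeff-*∷ : ∀ p b q n → coeff (p *ᴾ (b ∷ q)) n ≈ b * coeff p n + coeff (0# ∷ (p *ᴾ q)) n
  coeff-*∷ [] b q zero    = sym (trans (+-identityʳ _) (zeroʳ b))
  coeff-*∷ [] b q (suc n) = sym (trans (+-identityʳ _) (zeroʳ b))
  coeff-*∷ (a ∷ p) b q zero = +-congʳ (*-comm a b)
  coeff-*∷ (a ∷ p) b q (suc n) = begin
    coeff ((a ∷ p) *ᴾ (b ∷ q)) (suc n)
      ≈⟨ coeff-∷* a p (b ∷ q) (suc n) ⟩
    a * coeff q n + coeff (p *ᴾ (b ∷ q)) n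
      ≈⟨ +-congˡ (coeff-*∷ p b q n) ⟩
    a * coeff q n + (b * coeff p n + coeff (0# ∷ (p *ᴾ q)) n)
      ≈⟨ solve 3 (λ x y z → x :+ (y :+ z) := y :+ (x :+ z))
           refl (a * coeff q n) (b * coeff p n) (coeff (0# ∷ (p *ᴾ q)) n) ⟩
    b * coeff p n + (a * coeff q n + coeff (0# ∷ (p *ᴾ q)) n)
      ≈⟨ +-congˡ (coeff-∷* a p q n) ⟨
    b * coeff p n + coeff ((a ∷ p) *ᴾ q) n                             ∎

  *ᴾ-zeroʳ : ∀ p → p *ᴾ [] ≈ᴾ []
  *ᴾ-zeroʳ []      n       = refl
  *ᴾ-zeroʳ (a ∷ p) zero    = refl
  *ᴾ-zeroʳ (a ∷ p) (suc n) = *ᴾ-zeroʳ p n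

  *ᴾ-comm : ∀ p q → p *ᴾ q ≈ᴾ q *ᴾ p
  *ᴾ-comm []      q n = sym (*ᴾ-zeroʳ q n)
  *ᴾ-comm (a ∷ p) q n = begin
    coeff ((a ∷ p) *ᴾ q) n                   ≈⟨ coeff-∷* a p q n ⟩
    a * coeff q n + coeff (0# ∷ (p *ᴾ q)) n  ≈⟨ +-congˡ (∷-cong {p = p *ᴾ q} refl (*ᴾ-comm p q) n) ⟩
    a * coeff q n + coeff (0# ∷ (q *ᴾ p)) n  ≈⟨ coeff-*∷ q a p n ⟨
    coeff (q *ᴾ (a ∷ p)) n                   ∎

  *ᴾ-cong : ∀ p p′ q q′ → p ≈ᴾ p′ → q ≈ᴾ q′ → p *ᴾ q ≈ᴾ p′ *ᴾ q′
  *ᴾ-cong p p′ q q′ p≈p′ q≈q′ n = begin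
    coeff (p *ᴾ q) n    ≈⟨ *ᴾ-congˡ p q q′ q≈q′ n ⟩
    coeff (p *ᴾ q′) n   ≈⟨ *ᴾ-comm p q′ n ⟩
    coeff (q′ *ᴾ p) n   ≈⟨ *ᴾ-congˡ q′ p p′ p≈p′ n ⟩
    coeff (q′ *ᴾ p′) n  ≈⟨ *ᴾ-comm q′ p′ n ⟩
    coeff (p′ *ᴾ q′) n  ∎

  0∷-+ᴾ : ∀ p q n → coeff (0# ∷ (p +ᴾ q)) n ≈ coeff (0# ∷ p) n + coeff (0# ∷ q) n
  0∷-+ᴾ p q zero    = sym (+-identityʳ 0#)
  0∷-+ᴾ p q (suc n) = coeff-+ p q n

  *ᴾ-distribʳ : ∀ r p q → (p +ᴾ q) *ᴾ r ≈ᴾ p *ᴾ r +ᴾ q *ᴾ r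
  *ᴾ-distribʳ r []      q       n = refl
  *ᴾ-distribʳ r (a ∷ p) []      n = sym (+ᴾ-identityʳ ((a ∷ p) *ᴾ r) n)
  *ᴾ-distribʳ r (a ∷ p) (b ∷ q) n = begin
    coeff ((a + b ∷ (p +ᴾ q)) *ᴾ r) n
      ≈⟨ coeff-∷* (a + b) (p +ᴾ q) r n ⟩
    (a + b) * coeff r n + coeff (0# ∷ ((p +ᴾ q) *ᴾ r)) n
      ≈⟨ +-congˡ (trans (∷-cong {p = (p +ᴾ q) *ᴾ r} refl (*ᴾ-distribʳ r p q) n) (0∷-+ᴾ (p *ᴾ r) (q *ᴾ r) n)) ⟩
    (a + b) * coeff r n + (coeff (0# ∷ (p *ᴾ r)) n + coeff (0# ∷ (q *ᴾ r)) n)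
      ≈⟨ solve 5 (λ a b c x y → (a :+ b) :* c :+ (x :+ y) := (a :* c :+ x) :+ (b :* c :+ y))
           refl a b (coeff r n) _ _ ⟩
    (a * coeff r n + coeff (0# ∷ (p *ᴾ r)) n) + (b * coeff r n + coeff (0# ∷ (q *ᴾ r)) n)
      ≈⟨ trans (coeff-+ ((a ∷ p) *ᴾ r) ((b ∷ q) *ᴾ r) n) (+-cong (coeff-∷* a p r n) (coeff-∷* b q r n)) ⟨
    coeff ((a ∷ p) *ᴾ r +ᴾ (b ∷ q) *ᴾ r) n ∎

  map-*ᴾ : ∀ a p q → map (a *_) p *ᴾ q ≈ᴾ map (a *_) (p *ᴾ q)
  map-*ᴾ a []      q n = refl
  map-*ᴾ a (b ∷ p) q n = begin
    coeff ((a * b ∷ map (a *_) p) *ᴾ q) n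
      ≈⟨ coeff-∷* (a * b) (map (a *_) p) q n ⟩
    a * b * coeff q n + coeff (0# ∷ (map (a *_) p *ᴾ q)) n      ≈⟨ +-congˡ (shift n) ⟩
    a * b * coeff q n + a * coeff (0# ∷ (p *ᴾ q)) n
      ≈⟨ solve 4 (λ a b c x → a :* b :* c :+ a :* x := a :* (b :* c :+ x)) refl a b (coeff q n) _ ⟩
    a * (b * coeff q n + coeff (0# ∷ (p *ᴾ q)) n)               ≈⟨ *-congˡ (coeff-∷* b p q n) ⟨
    a * coeff ((b ∷ p) *ᴾ q) n                                  ≈⟨ coeff-map a ((b ∷ p) *ᴾ q) n ⟨
    coeff (map (a *_) ((b ∷ p) *ᴾ q)) n                         ∎
    where
    shift : ∀ n → coeff (0# ∷ (map (a *_) p *ᴾ q)) n ≈ a * coeff (0# ∷ (p *ᴾ q)) n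
    shift zero    = sym (zeroʳ a)
    shift (suc n) = trans (map-*ᴾ a p q n) (coeff-map a (p *ᴾ q) n)

  *ᴾ-assoc : ∀ p q r → (p *ᴾ q) *ᴾ r ≈ᴾ p *ᴾ (q *ᴾ r)
  *ᴾ-assoc []      q r n = refl
  *ᴾ-assoc (a ∷ p) q r n = begin
    coeff ((map (a *_) q +ᴾ (0# ∷ (p *ᴾ q))) *ᴾ r) n
      ≈⟨ trans (*ᴾ-distribʳ r (map (a *_) q) (0# ∷ (p *ᴾ q)) n) (coeff-+ (map (a *_) q *ᴾ r) _ n) ⟩
    coeff (map (a *_) q *ᴾ r) n + coeff ((0# ∷ (p *ᴾ q)) *ᴾ r) n
      ≈⟨ +-cong (trans (map-*ᴾ a q r n) (coeff-map a (q *ᴾ r) n)) (coeff-∷* 0# (p *ᴾ q) r n) ⟩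
    a * coeff (q *ᴾ r) n + (0# * coeff r n + coeff (0# ∷ ((p *ᴾ q) *ᴾ r)) n)
      ≈⟨ +-congˡ (trans (+-congʳ (zeroˡ _)) (+-identityˡ _)) ⟩
    a * coeff (q *ᴾ r) n + coeff (0# ∷ ((p *ᴾ q) *ᴾ r)) n
      ≈⟨ +-congˡ (∷-cong {p = (p *ᴾ q) *ᴾ r} refl (*ᴾ-assoc p q r) n) ⟩
    a * coeff (q *ᴾ r) n + coeff (0# ∷ (p *ᴾ (q *ᴾ r))) n
      ≈⟨ coeff-∷* a p (q *ᴾ r) n ⟨
    coeff ((a ∷ p) *ᴾ (q *ᴾ r)) n ∎

  *ᴾ-identityˡ : ∀ p → (1# ∷ []) *ᴾ p ≈ᴾ p
  *ᴾ-identityˡ p n = trans (coeff-∷* 1# [] p n) (trans (+-cong (*-identityˡ _) (0≈0∷[] n)) (+-identityʳ _))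
    where
    0≈0∷[] : ∀ n → coeff (0# ∷ []) n ≈ 0#
    0≈0∷[] zero    = refl
    0≈0∷[] (suc n) = refl

  polynomialRing : CommutativeRing c ℓ₁
  polynomialRing = record
    { Carrier = Poly
    ; _≈_ = _≈ᴾ_
    ; _+_ = _+ᴾ_
    ; _*_ = _*ᴾ_
    ; -_ = -ᴾ_
    ; 0# = []
    ; 1# = 1# ∷ []
    ; isCommutativeRing = record
      { isRing = record
        { +-isAbelianGroup = record
          { isGroup = record
            { isMonoid = record
              { isSemigroup = record
                { isMagma = record
                  { isEquivalence = record
                    { refl = λ n → refl
                    ; sym = λ p≈q n → sym (p≈q n)
                    ; trans = λ p≈q q≈r n → trans (p≈q n) (q≈r n)
                    }
                  ; ∙-cong = λ {p} {p′} {q} {q′} → +ᴾ-cong p p′ q q′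
                  }
                ; assoc = +ᴾ-assoc
                }
              ; identity = (λ p n → refl) , +ᴾ-identityʳ
              }
            ; inverse = -ᴾ-inverseˡ , λ p n → trans (+ᴾ-comm p (-ᴾ p) n) (-ᴾ-inverseˡ p n)
            ; ⁻¹-cong = λ {p} {q} p≈q n → trans (coeff-neg p n) (trans (-‿cong (p≈q n)) (sym (coeff-neg q n)))
            }
          ; comm = +ᴾ-comm
          }
        ; *-cong = λ {p} {p′} {q} {q′} → *ᴾ-cong p p′ q q′
        ; *-assoc = *ᴾ-assoc
        ; *-identity = *ᴾ-identityˡ , λ p n → trans (*ᴾ-comm p (1# ∷ []) n) (*ᴾ-identityˡ p n)
        ; distrib = (λ p q r n → trans (*ᴾ-comm p (q +ᴾ r) n) (trans (*ᴾ-distribʳ p q r n)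
                       (+ᴾ-cong (q *ᴾ p) (p *ᴾ q) (r *ᴾ p) (p *ᴾ r) (*ᴾ-comm q p) (*ᴾ-comm r p) n)))
                  , *ᴾ-distribʳ
        }
      ; *-comm = *ᴾ-comm
      }
    }

  -- Lists of different length can represent the same polynomial. When the shorter one runs out, the
  -- remaining coefficients of the other are all zero, and this lemma disposes of them.
  evaluate-≈[] : ∀ p x → p ≈ᴾ [] → evaluate p x ≈ 0#
  evaluate-≈[] []      x p≈0 = refl
  evaluate-≈[] (a ∷ p) x p≈0 = begin
    a + x * evaluate p x  ≈⟨ +-cong (p≈0 0) (*-congˡ (evaluate-≈[] p x (p≈0 ∘ suc))) ⟩
    0# + x * 0#           ≈⟨ trans (+-identityˡ _) (zeroʳ x) ⟩
    0#                    ∎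

  evaluate-cong : ∀ p q x → p ≈ᴾ q → evaluate p x ≈ evaluate q x
  evaluate-cong []      q       x p≈q = sym (evaluate-≈[] q x λ n → sym (p≈q n))
  evaluate-cong (a ∷ p) []      x p≈q = evaluate-≈[] (a ∷ p) x p≈q
  evaluate-cong (a ∷ p) (b ∷ q) x p≈q = +-cong (p≈q 0) (*-congˡ (evaluate-cong p q x (p≈q ∘ suc)))

  evaluate-+ : ∀ p q x → evaluate (p +ᴾ q) x ≈ evaluate p x + evaluate q x
  evaluate-+ []      q       x = sym (+-identityˡ _)
  evaluate-+ (a ∷ p) []      x = sym (+-identityʳ _)
  evaluate-+ (a ∷ p) (b ∷ q) x = begin
    a + b + x * evaluate (p +ᴾ q) x                  ≈⟨ +-congˡ (*-congˡ (evaluate-+ p q x)) ⟩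
    a + b + x * (evaluate p x + evaluate q x)
      ≈⟨ solve 5 (λ a b x s t → a :+ b :+ x :* (s :+ t) := (a :+ x :* s) :+ (b :+ x :* t))
           refl a b x _ _ ⟩
    (a + x * evaluate p x) + (b + x * evaluate q x)  ∎

  evaluate-map : ∀ a p x → evaluate (map (a *_) p) x ≈ a * evaluate p x
  evaluate-map a []      x = sym (zeroʳ a)
  evaluate-map a (b ∷ p) x = begin
    a * b + x * evaluate (map (a *_) p) x  ≈⟨ +-congˡ (*-congˡ (evaluate-map a p x)) ⟩
    a * b + x * (a * evaluate p x)
      ≈⟨ solve 4 (λ a b x s → a :* b :+ x :* (a :* s) := a :* (b :+ x :* s)) refl a b x _ ⟩
    a * (b + x * evaluate p x)             ∎

  evaluate-* : ∀ p q x → evaluate (p *ᴾ q) x ≈ evaluate p x * evaluate q x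
  evaluate-* []      q x = sym (zeroˡ _)
  evaluate-* (a ∷ p) q x = begin
    evaluate (map (a *_) q +ᴾ (0# ∷ (p *ᴾ q))) x
      ≈⟨ evaluate-+ (map (a *_) q) (0# ∷ (p *ᴾ q)) x ⟩
    evaluate (map (a *_) q) x + (0# + x * evaluate (p *ᴾ q) x)
      ≈⟨ +-cong (evaluate-map a q x) (+-congˡ (*-congˡ (evaluate-* p q x))) ⟩
    a * evaluate q x + (0# + x * (evaluate p x * evaluate q x))
      ≈⟨ solve 4 (λ a s t x → a :* s :+ (con 0 :+ x :* (t :* s)) := (a :+ x :* t) :* s)
           refl a (evaluate q x) (evaluate p x) x ⟩
    (a + x * evaluate p x) * evaluate q x ∎

  evaluate-constant : ∀ a x → evaluate (a ∷ []) x ≈ a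
  evaluate-constant a x = trans (+-congˡ (zeroʳ x)) (+-identityʳ a)

  evaluate-linear : ∀ a x → evaluate (- a ∷ 1# ∷ []) x ≈ x - a
  evaluate-linear a x = begin
    - a + x * (1# + x * 0#)  ≈⟨ +-congˡ (*-congˡ (evaluate-constant 1# x)) ⟩
    - a + x * 1#             ≈⟨ trans (+-congˡ (*-identityʳ x)) (+-comm _ _) ⟩
    x - a                    ∎

  linear≉0 : ∀ a → ¬ ((a ∷ 1# ∷ []) ≈ᴾ [])
  linear≉0 a eq = 0≉1 (sym (eq 1))

  open FractionArithmetic polynomialRing

  *ᴾ-zero-cancelʳ : ∀ p q → p *ᴾ q ≈ᴾ [] → ¬ (q ≈ᴾ []) → p ≈ᴾ []
  *ᴾ-zero-cancelʳ p q pq≈0 q≉0 = Sum.[ id , (λ q≈0 → contradiction q≈0 q≉0) ]′ (noZeroDivisors p q pq≈0)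

  -- It has the operations of `rationalFunctions`, over which `IsCoronal` is stated, so matrix
  -- identities valid in every commutative ring become available for the coronal. Transitivity is
  -- where `noZeroDivisors` enters; the congruences and algebraic laws reduce to cross-multiplied
  -- polynomial identities.
  rationalFunctionRing : CommutativeRing _ _
  rationalFunctionRing = record
    { Carrier = RationalFunction
    ; _≈_ = _≈ᴷ_
    ; _+_ = _+ᴷ_
    ; _*_ = _*ᴷ_
    ; -_ = -ᴷ_
    ; 0# = polynomial []
    ; 1# = polynomial (1# ∷ [])
    ; isCommutativeRing = record
      { isRing = record
        { +-isAbelianGroup = record
          { isGroup = record
            { isMonoid = record
              { isSemigroup = record
                { isMagma = record
                  { isEquivalence = record
                    { refl = λ n → refl
                    ; sym = λ f≈g n → sym (f≈g n)
                    ; trans = λ {f} {g} {h} → transᴷ f g h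
                    }
                  ; ∙-cong = λ {f} {f′} {g} {g′} → +-congᴷ f f′ g g′
                  }
                ; assoc = λ f g h → cross-+-assoc (num f) (den f) (num g) (den g) (num h) (den h)
                }
              ; identity = identityˡ , λ f → transᴷ (f +ᴷ 0ᴷ) (0ᴷ +ᴷ f) f (commᴷ f 0ᴷ) (identityˡ f)
              }
            ; inverse = inverseˡ , λ f → transᴷ (f +ᴷ (-ᴷ f)) ((-ᴷ f) +ᴷ f) 0ᴷ (commᴷ f (-ᴷ f)) (inverseˡ f)
            ; ⁻¹-cong = λ {f} {g} → cross-neg-cong (num f) (den f) (num g) (den g)
            }
          ; comm = commᴷ
          }
        ; *-cong = λ {f} {f′} {g} {g′} →
            cross-*-cong (num f) (den f) (num f′) (den f′) (num g) (den g) (num g′) (den g′)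
        ; *-assoc = λ f g h → cross-*-assoc (num f) (den f) (num g) (den g) (num h) (den h)
        ; *-identity = *-identityˡᴷ , λ f → transᴷ (f *ᴷ 1ᴷ) (1ᴷ *ᴷ f) f (*-commᴷ f 1ᴷ) (*-identityˡᴷ f)
        ; distrib = distribˡᴷ , λ f g h →
          transᴷ ((g +ᴷ h) *ᴷ f) (f *ᴷ (g +ᴷ h)) ((g *ᴷ f) +ᴷ (h *ᴷ f)) (*-commᴷ (g +ᴷ h) f)
            (transᴷ (f *ᴷ (g +ᴷ h)) ((f *ᴷ g) +ᴷ (f *ᴷ h)) ((g *ᴷ f) +ᴷ (h *ᴷ f)) (distribˡᴷ f g h)
              (+-congᴷ (f *ᴷ g) (g *ᴷ f) (f *ᴷ h) (h *ᴷ f) (*-commᴷ f g) (*-commᴷ f h)))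
        }
      ; *-comm = *-commᴷ
      }
    }
    where
    open RawRing rationalFunctions renaming (_≈_ to _≈ᴷ_; _+_ to _+ᴷ_; _*_ to _*ᴷ_; -_ to -ᴷ_; 0# to 0ᴷ; 1# to 1ᴷ)
    transᴷ : ∀ f g h → f ≈ᴷ g → g ≈ᴷ h → f ≈ᴷ h
    transᴷ f g h = cross-trans *ᴾ-zero-cancelʳ (num f) (den f) (num g) (den g) (num h) (den h) (den≉0 g)
    +-congᴷ : ∀ f f′ g g′ → f ≈ᴷ f′ → g ≈ᴷ g′ → (f +ᴷ g) ≈ᴷ (f′ +ᴷ g′)
    +-congᴷ f f′ g g′ = cross-+-cong (num f) (den f) (num f′) (den f′) (num g) (den g) (num g′) (den g′)
    commᴷ : ∀ f g → (f +ᴷ g) ≈ᴷ (g +ᴷ f)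
    commᴷ f g = cross-+-comm (num f) (den f) (num g) (den g)
    identityˡ : ∀ f → (0ᴷ +ᴷ f) ≈ᴷ f
    identityˡ f = cross-+-identityˡ (num f) (den f)
    inverseˡ : ∀ f → ((-ᴷ f) +ᴷ f) ≈ᴷ 0ᴷ
    inverseˡ f = cross-inverseˡ (num f) (den f)
    *-commᴷ : ∀ f g → (f *ᴷ g) ≈ᴷ (g *ᴷ f)
    *-commᴷ f g = cross-*-comm (num f) (den f) (num g) (den g)
    *-identityˡᴷ : ∀ f → (1ᴷ *ᴷ f) ≈ᴷ f
    *-identityˡᴷ f = cross-*-identityˡ (num f) (den f)
    distribˡᴷ : ∀ f g h → (f *ᴷ (g +ᴷ h)) ≈ᴷ ((f *ᴷ g) +ᴷ (f *ᴷ h))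
    distribˡᴷ f g h = cross-distribˡ (num f) (den f) (num g) (den g) (num h) (den h)

-- Integers in an ordered field, and eigenvalue lists.

module FieldProperties {c ℓ₁ ℓ₂} (F : RealClosedField c ℓ₁ ℓ₂) where
  open RealClosedField F hiding (zero)
  open Over F
  open SetoidReasoning setoid
  open RingProperties ring using (-1*x≈-x; -‿involutive; +-cancelʳ)
  open Multiples semiring using (×-homo-+)
  open SemiringSolver commutativeSemiring using (solve; con; _:+_; _:*_; _:=_)
  private
    module MP = MatrixProperties commutativeRing

  -‿+-cancelˡ : ∀ a x → a + (x - a) ≈ x
  -‿+-cancelˡ a x = begin
    a + (x - a)   ≈⟨ solve 3 (λ a x -a → a :+ (x :+ -a) := x :+ (a :+ -a)) refl a x (- a) ⟩
    x + (a - a)   ≈⟨ +-congˡ (-‿inverseʳ a) ⟩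
    x + 0#        ≈⟨ +-identityʳ x ⟩
    x             ∎

  +-‿cancelˡ : ∀ a x → (a + x) - a ≈ x
  +-‿cancelˡ a x = begin
    (a + x) - a   ≈⟨ +-assoc a x (- a) ⟩
    a + (x - a)   ≈⟨ -‿+-cancelˡ a x ⟩
    x             ∎

  *-cancelʳ-≉ : ∀ {a x y} → a ≉ 0# → x * a ≈ y * a → x ≈ y
  *-cancelʳ-≉ {a} {x} {y} a≉0 xa≈ya with inverse a a≉0
  ... | a⁻¹ , aa⁻¹≈1 = begin
    x              ≈⟨ *-identityʳ x ⟨
    x * 1#         ≈⟨ *-congˡ aa⁻¹≈1 ⟨
    x * (a * a⁻¹)  ≈⟨ *-assoc x a a⁻¹ ⟨
    x * a * a⁻¹    ≈⟨ *-congʳ xa≈ya ⟩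
    y * a * a⁻¹    ≈⟨ *-assoc y a a⁻¹ ⟩
    y * (a * a⁻¹)  ≈⟨ *-congˡ aa⁻¹≈1 ⟩
    y * 1#         ≈⟨ *-identityʳ y ⟩
    y              ∎

  <-resp-≈ : ∀ {x y x′ y′} → x ≈ x′ → y ≈ y′ → x < y → x′ < y′
  <-resp-≈ x≈x′ y≈y′ = proj₁ (IsStrictTotalOrder.<-resp-≈ isStrictTotalOrder) y≈y′
                       ∘ proj₂ (IsStrictTotalOrder.<-resp-≈ isStrictTotalOrder) x≈x′

  <-trans : ∀ {x y z} → x < y → y < z → x < z
  <-trans = IsStrictTotalOrder.trans isStrictTotalOrder

  0<1 : 0# < 1#
  0<1 with IsStrictTotalOrder.compare isStrictTotalOrder 0# 1#
  ... | tri< 0<1 _ _ = 0<1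
  ... | tri≈ _ 0≈1 _ = contradiction 0≈1 0≉1
  -- This case proves the goal instead of refuting the assumption: `- 1#` would be positive, and
  -- hence so would its square `1#`.
  ... | tri> _ _ 1<0 = <-resp-≈ refl -1*-1≈1 (*-pos 0<-1 0<-1)
    where
    0<-1 : 0# < - 1#
    0<-1 = <-resp-≈ (-‿inverseˡ 1#) (+-identityʳ _) (+-monoʳ-< (- 1#) 1<0)
    -1*-1≈1 : - 1# * - 1# ≈ 1#
    -1*-1≈1 = begin
      - 1# * - 1#      ≈⟨ -1*x≈-x (- 1#) ⟩
      - - 1#           ≈⟨ -‿involutive 1# ⟩
      1#               ∎

  0<fromℕ-suc : ∀ n → 0# < fromℕ (suc n)
  0<fromℕ-suc zero    = <-resp-≈ refl (sym (+-identityʳ 1#)) 0<1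
  0<fromℕ-suc (suc n) = <-trans 0<1 (<-resp-≈ (+-identityʳ 1#) refl (+-monoʳ-< 1# (0<fromℕ-suc n)))

  -- Characteristic zero, a consequence of the order. It rules out a value of the coronal at its
  -- pole.
  fromℕ≉0 : ∀ n .{{_ : NonZero n}} → fromℕ n ≉ 0#
  fromℕ≉0 (suc n) n≈0 = IsStrictTotalOrder.irrefl isStrictTotalOrder (sym n≈0) (0<fromℕ-suc n)

  fromℤ-⊖ : ∀ m n → fromℤ (m ⊖ n) + fromℕ n ≈ fromℕ m
  fromℤ-⊖ m       zero    = +-identityʳ _
  fromℤ-⊖ zero    (suc n) = -‿inverseˡ _
  fromℤ-⊖ (suc m) (suc n) = begin
    fromℤ (suc m ⊖ suc n) + (1# + fromℕ n)  ≡⟨ ≡.cong (λ z → fromℤ z + (1# + fromℕ n)) ([1+m]⊖[1+n]≡m⊖n m n) ⟩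
    fromℤ (m ⊖ n) + (1# + fromℕ n)
      ≈⟨ solve 2 (λ z k → z :+ (con 1 :+ k) := con 1 :+ (z :+ k)) refl _ _ ⟩
    1# + (fromℤ (m ⊖ n) + fromℕ n)          ≈⟨ +-congˡ (fromℤ-⊖ m n) ⟩
    1# + fromℕ m                            ∎

  IsInteger-cong : ∀ {x y} → x ≈ y → IsInteger x → IsInteger y
  IsInteger-cong x≈y (z , x≈z) = z , trans (sym x≈y) x≈z

  -- Describing an integer by `x + n = m` with natural `m` and `n` makes shifts by natural numbers a
  -- matter of addition, without cases on signs.
  IsInteger⇒difference : ∀ {x} → IsInteger x → ∃[ m ] ∃[ n ] x + fromℕ n ≈ fromℕ m
  IsInteger⇒difference (+ m , x≈m)        = m , 0 , trans (+-identityʳ _) x≈m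
  IsInteger⇒difference (-[1+ n ] , x≈-n)  = 0 , suc n , trans (+-congʳ x≈-n) (-‿inverseˡ _)

  difference⇒IsInteger : ∀ {x} m n → x + fromℕ n ≈ fromℕ m → IsInteger x
  difference⇒IsInteger {x} m n eq = m ⊖ n , +-cancelʳ (fromℕ n) x (fromℤ (m ⊖ n)) (trans eq (sym (fromℤ-⊖ m n)))

  fromℕ-+ : ∀ m n → fromℕ (m ℕ.+ n) ≈ fromℕ m + fromℕ n
  fromℕ-+ = ×-homo-+ 1#

  IsInteger-fromℕ : ∀ n → IsInteger (fromℕ n)
  IsInteger-fromℕ n = + n , refl

  IsInteger-+ : ∀ k {x} → IsInteger x → IsInteger (fromℕ k + x)
  IsInteger-+ k {x} x∈ℤ with IsInteger⇒difference x∈ℤ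
  ... | m , n , eq = difference⇒IsInteger (k ℕ.+ m) n (trans (+-assoc _ _ _) (trans (+-congˡ eq) (sym (fromℕ-+ k m))))

  IsInteger-+⁻ : ∀ k {x} → IsInteger (fromℕ k + x) → IsInteger x
  IsInteger-+⁻ k {x} k+x∈ℤ with IsInteger⇒difference k+x∈ℤ
  ... | m , n , eq = difference⇒IsInteger m (k ℕ.+ n) (begin
    x + fromℕ (k ℕ.+ n)          ≈⟨ +-congˡ (fromℕ-+ k n) ⟩
    x + (fromℕ k + fromℕ n)      ≈⟨ solve 3 (λ x k n → x :+ (k :+ n) := k :+ x :+ n) refl x _ _ ⟩
    fromℕ k + x + fromℕ n        ≈⟨ eq ⟩
    fromℕ m                      ∎)

  ≈𝟎? : ∀ {n} (v : Vector Carrier n) → Dec (v ≈ᵥ 𝟎)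
  ≈𝟎? v = all? λ i → v i ≟ 0#

  ≉𝟎⇒∃ : ∀ {n} (v : Vector Carrier n) → ¬ (v ≈ᵥ 𝟎) → ∃[ i ] v i ≉ 0#
  ≉𝟎⇒∃ {n} v = ¬∀⟶∃¬ n _ λ i → v i ≟ 0#

  -- Expand `w = Σ aₖ bₖ`. Independence turns the equation into `aₖ (p νₖ + q - x) = 0` for all `k`,
  -- and some `aₖ` is nonzero. The affine form `p A + q` fits the equation that the product yields
  -- for `S`, with `p = N`, and spares a division by `N`.
  eigenvalue-listed : ∀ {n} (A : Matrix n) ν → AreEigenvalues A ν → ∀ {p q x} w → ¬ (w ≈ᵥ 𝟎) →
                      (∀ i → p * (A *ᵥ w) i + q * w i ≈ x * w i) → ∃[ j ] p * ν j + q ≈ x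
  eigenvalue-listed {n} A ν (b , (independent , spanning) , Ab≈νb) {p} {q} {x} w w≉0 eq
    with spanning w
  ... | a , w≈ab = j , (begin
    p * ν j + q              ≈⟨ -‿+-cancelˡ x _ ⟨
    x + δ j                  ≈⟨ +-congˡ (cancel a[j]≉0 (independent (λ k → a k * δ k) aδb≈0 j)) ⟩
    x + 0#                   ≈⟨ +-identityʳ x ⟩
    x                        ∎)
    where
    δ : Fin n → Carrier
    δ k = (p * ν k + q) - x

    a≉0 : ¬ (a ≈ᵥ 𝟎)
    a≉0 a≈0 = w≉0 λ i → trans (w≈ab i) (trans (MP.∑-cong λ k → trans (*-congʳ (a≈0 k)) (zeroˡ _)) (MP.∑-zero n))

    j = proj₁ (≉𝟎⇒∃ a a≉0)
    a[j]≉0 = proj₂ (≉𝟎⇒∃ a a≉0)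

    Aw≈ : ∀ i → (A *ᵥ w) i ≈ ∑ λ k → a k * (ν k * b k i)
    Aw≈ i = begin
      (A *ᵥ w) i                          ≈⟨ MP.*ᵥ-cong A w≈ab i ⟩
      (A *ᵥ (λ l → ∑ λ k → a k * b k l)) i ≈⟨ MP.*ᵥ-∑ A (λ k l → a k * b k l) i ⟩
      ∑ (λ k → (A *ᵥ (a k ·ᵥ b k)) i)
        ≈⟨ MP.∑-cong (λ k → trans (MP.*ᵥ-·ᵥ A (a k) (b k) i) (*-congˡ (Ab≈νb k i))) ⟩
      ∑ (λ k → a k * (ν k * b k i))       ∎

    aδb≈0 : ∀ i → ∑ (λ k → a k * δ k * b k i) ≈ 0#
    aδb≈0 i = begin
      ∑ (λ k → a k * δ k * b k i)
        ≈⟨ MP.∑-cong (λ k → solve 6 (λ a p ν q -x b → a :* (p :* ν :+ q :+ -x) :* b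
             := p :* (a :* (ν :* b)) :+ (q :+ -x) :* (a :* b))
             refl (a k) p (ν k) q (- x) (b k i)) ⟩
      ∑ (λ k → p * (a k * (ν k * b k i)) + (q - x) * (a k * b k i))
        ≈⟨ MP.∑-distrib-+ (λ k → p * (a k * (ν k * b k i))) _ ⟩
      ∑ (λ k → p * (a k * (ν k * b k i))) + ∑ (λ k → (q - x) * (a k * b k i))
        ≈⟨ +-cong (MP.*-distribˡ-∑ p λ k → a k * (ν k * b k i)) (MP.*-distribˡ-∑ (q - x) λ k → a k * b k i) ⟨
      p * ∑ (λ k → a k * (ν k * b k i)) + (q - x) * ∑ (λ k → a k * b k i)
        ≈⟨ +-cong (*-congˡ (Aw≈ i)) (*-congˡ (w≈ab i)) ⟨
      p * (A *ᵥ w) i + (q - x) * w i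
        ≈⟨ solve 4 (λ s q -x w → s :+ (q :+ -x) :* w := s :+ q :* w :+ -x :* w)
             refl (p * (A *ᵥ w) i) q (- x) (w i) ⟩
      p * (A *ᵥ w) i + q * w i + - x * w i
        ≈⟨ trans (+-congʳ (eq i)) (sym (distribʳ (w i) x (- x))) ⟩
      (x - x) * w i
        ≈⟨ trans (*-congʳ (-‿inverseʳ x)) (zeroˡ _) ⟩
      0# ∎

  -- If `b i` vanished, the indicator of `i` would be a nontrivial linear relation.
  basis≉0 : ∀ {n} {b : Fin n → Vector Carrier n} → IsBasis b → ∀ i → ¬ (b i ≈ᵥ 𝟎)
  basis≉0 {n} {b} (independent , _) i b[i]≈0 = 0≉1 (sym (begin
    1#                                  ≡⟨ ≡.cong (if_then 1# else 0#) (dec-true (i ≟ᶠ i) ≡.refl) ⟨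
    (if does (i ≟ᶠ i) then 1# else 0#)
      ≈⟨ independent (λ j → if does (i ≟ᶠ j) then 1# else 0#) e[i]b≈0 i ⟩
    0#                                  ∎))
    where
    e[i]b≈0 : ∀ l → ∑ (λ j → (if does (i ≟ᶠ j) then 1# else 0#) * b j l) ≈ 0#
    e[i]b≈0 l = begin
      ∑ (λ j → (if does (i ≟ᶠ j) then 1# else 0#) * b j l)
        ≈⟨ MP.∑-cong (λ j → MP.if-* (does (i ≟ᶠ j)) (b j l)) ⟩
      ∑ (λ j → if does (i ≟ᶠ j) then 1# * b j l else 0#)       ≈⟨ MP.∑-if-≟ i (λ j → 1# * b j l) ⟩
      1# * b i l                                               ≈⟨ trans (*-identityˡ _) (b[i]≈0 l) ⟩
      0#                                                       ∎

-- The coronal of a regular graph and its values.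

module RegularCoronal {c ℓ₁ ℓ₂} (F : RealClosedField c ℓ₁ ℓ₂) where
  open RealClosedField F hiding (zero)
  open Over F
  open FieldProperties F
  open RationalFunctionProperties F
  open SemiringSolver commutativeSemiring using (solve; con; _:+_; _:*_; _:=_)
  private
    module P = CommutativeRing polynomialRing
    module K = CommutativeRing rationalFunctionRing
    module MK = Matrices rationalFunctions
    module MKP = MatrixProperties rationalFunctionRing
    module MP = MatrixProperties commutativeRing

  constant-cong : ∀ {a b} → a ≈ b → constant a K.≈ constant b
  constant-cong {a} {b} a≈b = *ᴾ-cong (a ∷ []) (b ∷ []) (1# ∷ []) (1# ∷ [])
    (∷-cong {p = []} {q = []} a≈b λ _ → refl) λ _ → refl

  constant-+ : ∀ a b → constant a K.+ constant b K.≈ constant (a + b)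
  constant-+ a b zero = solve 2 (λ a b → ((a :* con 1 :+ con 0) :+ (b :* con 1 :+ con 0)) :* con 1 :+ con 0
                                      := (a :+ b) :* (con 1 :* con 1 :+ con 0) :+ con 0) refl a b
  constant-+ a b (suc zero)    = refl
  constant-+ a b (suc (suc n)) = refl

  constant-∑ : ∀ {n} (f : Vector Carrier n) → MK.∑ (λ i → constant (f i)) K.≈ constant (∑ f)
  constant-∑ {zero}  f zero    = sym (trans (+-congʳ (zeroˡ _)) (+-identityʳ _))
  constant-∑ {zero}  f (suc n) = refl
  constant-∑ {suc n} f = K.trans
    {i = constant (f zero) K.+ MK.∑ (λ i → constant (f (suc i)))}
    {j = constant (f zero) K.+ constant (∑ (f ∘ suc))} {k = constant (∑ f)}
    (K.+-congˡ {constant (f zero)} {MK.∑ λ i → constant (f (suc i))} {constant (∑ (f ∘ suc))}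
      (constant-∑ (f ∘ suc)))
    (constant-+ (f zero) (∑ (f ∘ suc)))

  -- All rows of `X I - Q` have the sum `X - 2 r`, so the identity for `𝟏ᵀ A⁻¹ 𝟏` under constant row
  -- sums applies.
  regular-coronal : ∀ {n r} (G : Graph n) → Regular r G → ∀ χ → IsCoronal (signlessLaplacian G) χ →
                    (X K.- constant (fromℕ r + fromℕ r)) K.* χ K.≈ constant (fromℕ n)
  regular-coronal {n} {r} G regular χ (B , inverse , χ≈) = begin
    (X K.- constant d) K.* χ
      ≈⟨ K.*-congˡ {X K.- constant d} {χ} {MK.𝟏 MK.∙ᵥ (B MK.*ᵥ MK.𝟏)} χ≈ ⟩
    (X K.- constant d) K.* (MK.𝟏 MK.∙ᵥ (B MK.*ᵥ MK.𝟏))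
      ≈⟨ MKP.rowSum-*-𝟏ᵀA⁻¹𝟏 {A = M} {B} {X K.- constant d} inverse row ⟩
    MK.∑ {n} MK.𝟏                                    ≈⟨ constant-∑ {n} 𝟏 ⟩
    constant (∑ {n} 𝟏)
      ≈⟨ constant-cong (trans (MP.∑-const n 1#) (*-identityʳ _)) ⟩
    constant (fromℕ n)                               ∎
    where
    open SetoidReasoning K.setoid
    Q = signlessLaplacian G
    d = fromℕ r + fromℕ r
    M : MK.Matrix n
    M = MK.scalar X MK.-ᴹ λ i j → constant (Q i j)
    ∑-row : ∀ i → ∑ (Q i) ≈ d
    ∑-row i = trans (sym (MP.*ᵥ-𝟏 Q i)) (trans (MP.regular-*ᵥ-const G regular 1# i) (*-identityʳ d))
    row : ∀ i → (M MK.*ᵥ MK.𝟏) i K.≈ X K.- constant d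
    row i = begin
      (M MK.*ᵥ MK.𝟏) i
        ≈⟨ MKP.scalar-ᴹ-*ᵥ-𝟏 X (λ i j → constant (Q i j)) i ⟩
      X K.- MK.∑ (λ j → constant (Q i j))
        ≈⟨ K.+-congˡ {X} {K.- MK.∑ (λ j → constant (Q i j))} {K.- constant (∑ (Q i))}
                                                        (K.-‿cong {MK.∑ (λ j → constant (Q i j))} {constant (∑ (Q i))} (constant-∑ (Q i))) ⟩
      X K.- constant (∑ (Q i))
        ≈⟨ K.+-congˡ {X} {K.- constant (∑ (Q i))} {K.- constant d}
                                                        (K.-‿cong {constant (∑ (Q i))} {constant d} (constant-cong (∑-row i))) ⟩
      X K.- constant d                            ∎

  module _ {n r} (G : Graph n) (regular : Regular r G) (χ : RationalFunction)
           (coronal : IsCoronal (signlessLaplacian G) χ) where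
    private
      d = fromℕ r + fromℕ r
      L = - d ∷ 1# ∷ []
      N = fromℕ n ∷ []

    -- Cross-multiplied, this says that `χ` is the fraction `N / L`, and it is used below as exactly
    -- that equality.
    num*linear : num χ *ᴾ L ≈ᴾ N *ᴾ den χ
    num*linear = begin
      num χ *ᴾ L                     ≈⟨ *ᴾ-comm (num χ) L ⟩
      L *ᴾ num χ                     ≈⟨ *ᴾ-cong L nX (num χ) (num χ) L≈nX (λ _ → refl) ⟩
      nX *ᴾ num χ                    ≈⟨ P.*-identityʳ (nX *ᴾ num χ) ⟨
      -- `X`, the constant `d` and the constant `n` all have denominator `1ᴾ`, so unfolding the
      -- equality of rational functions leaves these factors to be stripped.
      (nX *ᴾ num χ) *ᴾ 1ᴾ            ≈⟨ regular-coronal G regular χ coronal ⟩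
      N *ᴾ ((1ᴾ *ᴾ 1ᴾ) *ᴾ den χ)     ≈⟨ *ᴾ-congˡ N ((1ᴾ *ᴾ 1ᴾ) *ᴾ den χ) (1ᴾ *ᴾ den χ)
                                          (*ᴾ-cong (1ᴾ *ᴾ 1ᴾ) 1ᴾ (den χ) (den χ) (*ᴾ-identityˡ 1ᴾ) (λ _ → refl)) ⟩
      N *ᴾ (1ᴾ *ᴾ den χ)             ≈⟨ *ᴾ-congˡ N (1ᴾ *ᴾ den χ) (den χ) (*ᴾ-identityˡ (den χ)) ⟩
      N *ᴾ den χ                     ∎
      where
      open SetoidReasoning P.setoid
      1ᴾ = 1# ∷ []
      nX = num (X K.- constant d)
      L≈nX : L ≈ᴾ nX
      L≈nX zero          = sym (solve 1 (λ -d → (con 0 :* con 1 :+ con 0) :+ (-d :* con 1 :+ con 0)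
           := -d)
           refl (- d))
      L≈nX (suc zero)    = sym (trans (+-identityʳ _) (*-identityʳ 1#))
      L≈nX (suc (suc m)) = refl

    open SetoidReasoning setoid

    -- The representative `g` that witnesses the value also equals `N / L`. Evaluating the
    -- cross-multiplied equality at `z` and cancelling the nonzero `den g` gives the claim.
    coronal-value⇒ : ∀ z y → HasValue χ z y → y * (z - d) ≈ fromℕ n
    coronal-value⇒ z y (g , χ≈g , den≉0 , num≈) = *-cancelʳ-≉ den≉0 (begin
      y * (z - d) * evaluate (den g) z
        ≈⟨ solve 3 (λ y d e → y :* d :* e := y :* e :* d) refl y (z - d) _ ⟩
      y * evaluate (den g) z * (z - d)             ≈⟨ *-cong num≈ (evaluate-linear d z) ⟨
      evaluate (num g) z * evaluate L z            ≈⟨ evaluate-* (num g) L z ⟨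
      evaluate (num g *ᴾ L) z
        ≈⟨ evaluate-cong (num g *ᴾ L) (N *ᴾ den g) z g≈N/L ⟩
      evaluate (N *ᴾ den g) z                      ≈⟨ evaluate-* N (den g) z ⟩
      evaluate N z * evaluate (den g) z            ≈⟨ *-congʳ (evaluate-constant (fromℕ n) z) ⟩
      fromℕ n * evaluate (den g) z                 ∎)
      where
      g≈N/L : g K.≈ fraction N L (linear≉0 (- d))
      g≈N/L = K.trans {g} {χ} {fraction N L (linear≉0 (- d))} (K.sym {χ} {g} χ≈g) num*linear

    -- `N / L` itself serves as the representative. Its denominator `z - d` cannot vanish, as
    -- otherwise `y * 0#` would be the nonzero `n`.
    coronal-value⇐ : .{{_ : NonZero n}} → ∀ z y → y * (z - d) ≈ fromℕ n → HasValue χ z y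
    coronal-value⇐ z y y[z-d]≈n = fraction N L (linear≉0 (- d)) , num*linear , L[z]≉0
      , trans (evaluate-constant (fromℕ n) z) (trans (sym y[z-d]≈n) (*-congˡ (sym (evaluate-linear d z))))
      where
      L[z]≉0 : ¬ (evaluate L z ≈ 0#)
      L[z]≉0 L[z]≈0 = fromℕ≉0 n (begin
        fromℕ n         ≈⟨ y[z-d]≈n ⟨
        y * (z - d)     ≈⟨ *-congˡ (trans (sym (evaluate-linear d z)) L[z]≈0) ⟩
        y * 0#          ≈⟨ zeroʳ y ⟩
        0#              ∎)

    -- The rational function is traded for two polynomial equations in `x` and `y`, the form in
    -- which the eigenvalue equations of the product produce them.
    coronal-root⇒ : ∀ {ν x} → IsCoronalRoot n ν χ x →
                    ∃[ y ] y * (x - fromℕ n - d) ≈ fromℕ n × fromℕ n + fromℕ n * ν + fromℕ n * y ≈ x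
    coronal-root⇒ {ν} {x} (y , value , root) = y , coronal-value⇒ _ y value , (begin
      m + m * ν + m * y                                  ≈⟨ +-identityʳ _ ⟨
      m + m * ν + m * y + 0#                             ≈⟨ +-congˡ root ⟨
      m + m * ν + m * y + (x - m - m * ν - m * y)
        ≈⟨ trans (+-assoc (m + m * ν) (m * y) _) (+-congˡ (-‿+-cancelˡ (m * y) (x - m - m * ν))) ⟩
      m + m * ν + (x - m - m * ν)
        ≈⟨ trans (+-assoc m (m * ν) _) (+-congˡ (-‿+-cancelˡ (m * ν) (x - m))) ⟩
      m + (x - m)                                        ≈⟨ -‿+-cancelˡ m x ⟩
      x                                                  ∎)
      where m = fromℕ n

    coronal-root⇐ : .{{_ : NonZero n}} → ∀ {ν x y} → y * (x - fromℕ n - d) ≈ fromℕ n →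
                    fromℕ n + fromℕ n * ν + fromℕ n * y ≈ x → IsCoronalRoot n ν χ x
    coronal-root⇐ {ν} {x} {y} value x≈ = y , coronal-value⇐ (x - fromℕ n) y value , (begin
      x - m - m * ν - m * y                        ≈⟨ +-congʳ (+-congʳ (+-congʳ x≈)) ⟨
      m + m * ν + m * y - m - m * ν - m * y
        ≈⟨ +-congʳ (+-congʳ (trans (+-congʳ (+-assoc m (m * ν) (m * y))) (+-‿cancelˡ m _))) ⟩
      m * ν + m * y - m * ν - m * y                ≈⟨ +-congʳ (+-‿cancelˡ (m * ν) (m * y)) ⟩
      m * y - m * y                                ≈⟨ -‿inverseʳ (m * y) ⟩
      0#                                           ∎)
      where m = fromℕ n

-- Eigenvalues of the product.

module ProductSpectrum {c ℓ₁ ℓ₂} (F : RealClosedField c ℓ₁ ℓ₂) where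
  open RealClosedField F hiding (zero)
  open Over F
  open FieldProperties F
  open RegularCoronal F
  open SetoidReasoning setoid
  open SemiringSolver commutativeSemiring using (solve; _:+_; _:*_; _:=_)
  open Multiples semiring using (×1-homo-*)
  open RingProperties ring using (-‿distribˡ-*; +-cancelˡ)
  private
    module MP = MatrixProperties commutativeRing

  module _ {n₁ n₂ r₁ r₂ : ℕ} .{{_ : NonZero n₁}} .{{_ : NonZero n₂}} (G₁ : Graph n₁) (G₂ : Graph n₂)
           (reg₁ : Regular r₁ G₁) (reg₂ : Regular r₂ G₂) where
    open MP.Product G₁ G₂

    private
      Q₁ = signlessLaplacian G₁
      Q₂ = signlessLaplacian G₂
      A₁ = adjacencyMatrix G₁
      N = fromℕ n₂
      D = fromℕ r₂ + fromℕ r₂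

      Blocks : Set c
      Blocks = Fin n₁ → Vector Carrier n₂

      sums : Blocks → Vector Carrier n₁
      sums α i = ∑ (α i)

      EigenA EigenB : Blocks → Blocks → Carrier → Set ℓ₁
      EigenA α β x = ∀ i k → (N * fromℕ r₁ + N) * α i k + (A₁ *ᵥ sums α) i + sums β i ≈ x * α i k
      EigenB α β x = ∀ i k → N * β i k + (Q₂ *ᵥ β i) k + sums α i ≈ x * β i k

      on-vertices : ∀ {p} (P : Fin (n₁ ℕ.* n₂ ℕ.+ n₁ ℕ.* n₂) → Set p) →
                    (∀ i k → P (index (inj₁ (i , k)))) → (∀ i k → P (index (inj₂ (i , k)))) → ∀ x → P x
      on-vertices P pa pb x = ≡.subst P (index-vertex {n₁} {n₂} x) (at (⊛-vertex n₁ n₂ x))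
        where
        at : ∀ u → P (index u)
        at (inj₁ (i , k)) = pa i k
        at (inj₂ (i , k)) = pb i k

    ⊛-eigenvalue⇒ : ∀ {x} → IsEigenvalue (signlessLaplacian (G₁ ⊛ G₂)) x →
                    ∃[ α ] ∃[ β ] ¬ ((∀ i → α i ≈ᵥ 𝟎) × (∀ i → β i ≈ᵥ 𝟎)) × EigenA α β x × EigenB α β x
    ⊛-eigenvalue⇒ (v , v≉0 , Qv≈xv) = α , β
      , (λ { (α≈0 , β≈0) → v≉0 (on-vertices (λ y → v y ≈ 0#) α≈0 β≈0) })
      , (λ i k → trans (sym (⊛-*ᵥ-a reg₁ reg₂ v α β v-α v-β i k)) (Qv≈xv (index (inj₁ (i , k)))))
      , (λ i k → trans (sym (⊛-*ᵥ-b reg₁ reg₂ v α β v-α v-β i k)) (Qv≈xv (index (inj₂ (i , k)))))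
      where
      α β : Blocks
      α i k = v (index (inj₁ (i , k)))
      β i k = v (index (inj₂ (i , k)))
      v-α : ∀ i k → v (index (inj₁ (i , k))) ≈ α i k
      v-α i k = refl
      v-β : ∀ i k → v (index (inj₂ (i , k))) ≈ β i k
      v-β i k = refl

    ⊛-eigenvalue⇐ : ∀ {x} α β → ¬ ((∀ i → α i ≈ᵥ 𝟎) × (∀ i → β i ≈ᵥ 𝟎)) → EigenA α β x → EigenB α β x →
                    IsEigenvalue (signlessLaplacian (G₁ ⊛ G₂)) x
    ⊛-eigenvalue⇐ {x} α β αβ≉0 eqA eqB = v
      , (λ v≈0 → αβ≉0 ((λ i k → trans (sym (v-α i k)) (v≈0 (index (inj₁ (i , k)))))
                     , (λ i k → trans (sym (v-β i k)) (v≈0 (index (inj₂ (i , k)))))))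
      , on-vertices (λ y → (signlessLaplacian (G₁ ⊛ G₂) *ᵥ v) y ≈ x * v y)
          (λ i k → trans (⊛-*ᵥ-a reg₁ reg₂ v α β v-α v-β i k) (trans (eqA i k) (*-congˡ (sym (v-α i k)))))
          (λ i k → trans (⊛-*ᵥ-b reg₁ reg₂ v α β v-α v-β i k) (trans (eqB i k) (*-congˡ (sym (v-β i k)))))
      where
      block : ⊛-Vertex n₁ n₂ → Carrier
      block = Sum.[ (λ { (i , k) → α i k }) , (λ { (i , k) → β i k }) ]′
      v : Vector Carrier (n₁ ℕ.* n₂ ℕ.+ n₁ ℕ.* n₂)
      v = block ∘ ⊛-vertex n₁ n₂
      v-α : ∀ i k → v (index (inj₁ (i , k))) ≈ α i k
      v-α i k = reflexive (≡.cong block (vertex-index (inj₁ (i , k))))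
      v-β : ∀ i k → v (index (inj₂ (i , k))) ≈ β i k
      v-β i k = reflexive (≡.cong block (vertex-index (inj₂ (i , k))))

    -- Summing `Q₂ v = μ v` gives `D (∑ v) = μ (∑ v)`, so `μ ≉ D` forces `∑ v = 0`. Then `v` placed
    -- on the `b`-vertices sends nothing to the `a`-vertices.
    eigenvalue-G₂⇒⊛ : ∀ {μ} → μ ≉ D → IsEigenvalue Q₂ μ → IsEigenvalue (signlessLaplacian (G₁ ⊛ G₂)) (N + μ)
    eigenvalue-G₂⇒⊛ {μ} μ≉D (v , v≉0 , Qv≈μv) = ⊛-eigenvalue⇐ (λ _ → 𝟎) β
      (λ { (_ , β≈0) → v≉0 λ k → trans (sym (*-identityˡ (v k))) (trans (*-congʳ (sym δ[0]≈1)) (β≈0 i₀ k)) })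
      (λ i k → begin
        (N * fromℕ r₁ + N) * 0# + (A₁ *ᵥ sums (λ _ → 𝟎)) i + sums β i
          ≈⟨ +-cong (+-cong (zeroʳ _) (MP.*ᵥ-≈𝟎 A₁ (λ _ → MP.∑-zero n₂) i))
                    (trans (sym (MP.*-distribˡ-∑ (δ i) v)) (trans (*-congˡ ∑v≈0) (zeroʳ (δ i)))) ⟩
        0# + 0# + 0#   ≈⟨ trans (+-identityʳ _) (+-identityʳ _) ⟩
        0#             ≈⟨ zeroʳ (N + μ) ⟨
        (N + μ) * 0#   ∎)
      (λ i k → begin
        N * β i k + (Q₂ *ᵥ β i) k + ∑ {n₂} 𝟎    ≈⟨ trans (+-congˡ (MP.∑-zero n₂)) (+-identityʳ _) ⟩
        N * β i k + (Q₂ *ᵥ β i) k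
          ≈⟨ +-congˡ (trans (MP.*ᵥ-·ᵥ Q₂ (δ i) v k) (*-congˡ (Qv≈μv k))) ⟩
        N * (δ i * v k) + δ i * (μ * v k)
          ≈⟨ solve 4 (λ n d v m → n :* (d :* v) :+ d :* (m :* v) := (n :+ m) :* (d :* v))
               refl N (δ i) (v k) μ ⟩
        (N + μ) * β i k                        ∎)
      where
      -- One copy of `G₂` carries the eigenvector, all others are zero; `n₁` being nonzero provides
      -- that copy.
      i₀ : Fin n₁
      i₀ = fromℕ< (ℕ.>-nonZero⁻¹ n₁)
      δ : Fin n₁ → Carrier
      δ i = if does (i₀ ≟ᶠ i) then 1# else 0#
      δ[0]≈1 : δ i₀ ≈ 1#
      δ[0]≈1 = reflexive (≡.cong (if_then 1# else 0#) (dec-true (i₀ ≟ᶠ i₀) ≡.refl))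
      β : Blocks
      β i = δ i ·ᵥ v
      μ∑v≈D∑v : μ * ∑ v ≈ D * ∑ v
      μ∑v≈D∑v = begin
        μ * ∑ v             ≈⟨ MP.*-distribˡ-∑ μ v ⟩
        ∑ (μ ·ᵥ v)          ≈⟨ MP.∑-cong Qv≈μv ⟨
        ∑ (Q₂ *ᵥ v)         ≈⟨ MP.regular-∑-*ᵥ G₂ reg₂ v ⟩
        D * ∑ v             ∎
      ∑v≈0 : ∑ v ≈ 0#
      ∑v≈0 with ∑ v ≟ 0#
      ... | yes ∑v≈0 = ∑v≈0
      ... | no  ∑v≉0 = contradiction (*-cancelʳ-≉ ∑v≉0 μ∑v≈D∑v) μ≉D

    -- Take `α` and `β` constant in `k`, with `α = w` and `β = y w`. The equation at the
    -- `b`-vertices then reduces to `y (x - N - D) = N`, and the one at the `a`-vertices to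
    -- `x = N + N ν + N y`.
    eigenvector-G₁⇒⊛ : ∀ {w ν x y} → ¬ (w ≈ᵥ 𝟎) → Q₁ *ᵥ w ≈ᵥ ν ·ᵥ w →
                       y * (x - N - D) ≈ N → N + N * ν + N * y ≈ x →
                       IsEigenvalue (signlessLaplacian (G₁ ⊛ G₂)) x
    eigenvector-G₁⇒⊛ {w} {ν} {x} {y} w≉0 Qw≈νw y*≈N x≈ = ⊛-eigenvalue⇐ α β
      (λ { (α≈0 , _) → w≉0 λ i → α≈0 i (fromℕ< (ℕ.>-nonZero⁻¹ n₂)) })
      (λ i k → begin
        (N * fromℕ r₁ + N) * w i + (A₁ *ᵥ sums α) i + sums β i
          ≈⟨ +-cong (+-congˡ (trans (MP.*ᵥ-cong A₁ (λ j → MP.∑-const n₂ (w j)) i) (MP.*ᵥ-·ᵥ A₁ N w i))) (MP.∑-const n₂ (y * w i)) ⟩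
        (N * fromℕ r₁ + N) * w i + N * (A₁ *ᵥ w) i + N * (y * w i)
          ≈⟨ solve 5 (λ n r w a y → (n :* r :+ n) :* w :+ n :* a :+ n :* (y :* w)
               := n :* w :+ n :* (r :* w :+ a) :+ n :* (y :* w))
               refl N (fromℕ r₁) (w i) ((A₁ *ᵥ w) i) y ⟩
        N * w i + N * (fromℕ r₁ * w i + (A₁ *ᵥ w) i) + N * (y * w i)
          ≈⟨ +-congʳ (+-congˡ (*-congˡ (trans (sym (MP.regular-*ᵥ G₁ reg₁ w i)) (Qw≈νw i)))) ⟩
        N * w i + N * (ν * w i) + N * (y * w i)
          ≈⟨ solve 4 (λ n w v y → n :* w :+ n :* (v :* w) :+ n :* (y :* w)
               := (n :+ n :* v :+ n :* y) :* w)
               refl N (w i) ν y ⟩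
        (N + N * ν + N * y) * w i
          ≈⟨ *-congʳ x≈ ⟩
        x * w i ∎)
      (λ i k → begin
        N * (y * w i) + (Q₂ *ᵥ β i) k + sums α i
          ≈⟨ +-cong (+-congˡ (MP.regular-*ᵥ-const G₂ reg₂ (y * w i) k)) (MP.∑-const n₂ (w i)) ⟩
        N * (y * w i) + D * (y * w i) + N * w i
          ≈⟨ +-congˡ (*-congʳ y*≈N) ⟨
        N * (y * w i) + D * (y * w i) + y * (x - N - D) * w i
          ≈⟨ solve 5 (λ n y w d z → n :* (y :* w) :+ d :* (y :* w) :+ y :* z :* w
               := (n :+ (d :+ z)) :* (y :* w))
               refl N y (w i) D (x - N - D) ⟩
        (N + (D + (x - N - D))) * (y * w i)
          ≈⟨ *-congʳ (trans (+-congˡ (-‿+-cancelˡ D (x - N))) (-‿+-cancelˡ N x)) ⟩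
        x * (y * w i) ∎)
      where
      α β : Blocks
      α i _ = w i
      β i _ = y * w i

    module _ (ν : Fin n₁ → Carrier) (eigenvalues : AreEigenvalues Q₁ ν)
             (χ : RationalFunction) (coronal : IsCoronal Q₂ χ) where

      integral⇒ : SignlessLaplacianIntegral (G₁ ⊛ G₂) →
                  SignlessLaplacianIntegral G₂ × (∀ i x → IsCoronalRoot n₂ (ν i) χ x → IsInteger x)
      integral⇒ integral = integral₂ , integral-roots
        where
        integral₂ : SignlessLaplacianIntegral G₂
        integral₂ μ μ-eigen with μ ≟ D
        -- The value excluded from the lifting is `2 r₂`, an integer in any case.
        ... | yes μ≈D = IsInteger-cong (sym μ≈D) (IsInteger-+ r₂ (IsInteger-fromℕ r₂))
        ... | no  μ≉D = IsInteger-+⁻ n₂ (integral (N + μ) (eigenvalue-G₂⇒⊛ μ≉D μ-eigen))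

        integral-roots : ∀ i x → IsCoronalRoot n₂ (ν i) χ x → IsInteger x
        integral-roots i x root =
          let b , basis , Qb≈νb = eigenvalues
              y , y*≈N , x≈     = coronal-root⇒ G₂ reg₂ χ coronal {ν i} root
          in integral x (eigenvector-G₁⇒⊛ (basis≉0 basis i) (Qb≈νb i) y*≈N x≈)

      integral⇐ : SignlessLaplacianIntegral G₂ × (∀ i x → IsCoronalRoot n₂ (ν i) χ x → IsInteger x) →
                  SignlessLaplacianIntegral (G₁ ⊛ G₂)
      integral⇐ (integral₂ , integral-roots) x x-eigen with ⊛-eigenvalue⇒ x-eigen
      ... | α , β , αβ≉0 , eqA , eqB with ≈𝟎? (sums α)
      ... | yes S≈0 with all? (λ i → ≈𝟎? (β i))
      -- With `S = 0` the equation at the `b`-vertices decouples into one eigenvalue equation of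
      -- `Q₂` for each `i`; a nonzero `β i` makes it genuine.
      ... | no β≉0 = IsInteger-cong (-‿+-cancelˡ N x) (IsInteger-+ n₂ (integral₂ (x - N) (β i , β[i]≉0 , Qβ≈)))
        where
        i = proj₁ (¬∀⟶∃¬ n₁ _ (λ i → ≈𝟎? (β i)) β≉0)
        β[i]≉0 = proj₂ (¬∀⟶∃¬ n₁ _ (λ i → ≈𝟎? (β i)) β≉0)
        Qβ≈ : Q₂ *ᵥ β i ≈ᵥ (x - N) ·ᵥ β i
        Qβ≈ k = begin
          (Q₂ *ᵥ β i) k                                       ≈⟨ +-‿cancelˡ (N * β i k) _ ⟨
          N * β i k + (Q₂ *ᵥ β i) k - N * β i k
            ≈⟨ +-congʳ (trans (sym (+-identityʳ _)) (+-congˡ (sym (S≈0 i)))) ⟩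
          N * β i k + (Q₂ *ᵥ β i) k + sums α i - N * β i k
            ≈⟨ +-cong (eqB i k) (-‿distribˡ-* N (β i k)) ⟩
          x * β i k + - N * β i k                             ≈⟨ distribʳ (β i k) x (- N) ⟨
          (x - N) * β i k                                     ∎
      -- Now `α` must be nonzero somewhere, and at such an entry only the diagonal term of the
      -- `a`-equation survives.
      ... | yes β≈0 = IsInteger-cong Nr₁+N≈x (IsInteger-fromℕ (n₂ ℕ.* r₁ ℕ.+ n₂))
        where
        α≉0 : ¬ (∀ i → α i ≈ᵥ 𝟎)
        α≉0 α≈0 = αβ≉0 (α≈0 , β≈0)
        i = proj₁ (¬∀⟶∃¬ n₁ _ (λ i → ≈𝟎? (α i)) α≉0)
        α[i]≉0 = ≉𝟎⇒∃ (α i) (proj₂ (¬∀⟶∃¬ n₁ _ (λ i → ≈𝟎? (α i)) α≉0))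
        k = proj₁ α[i]≉0
        Nr₁+N≈x : fromℕ (n₂ ℕ.* r₁ ℕ.+ n₂) ≈ x
        Nr₁+N≈x = trans (trans (fromℕ-+ (n₂ ℕ.* r₁) n₂) (+-congʳ (×1-homo-* n₂ r₁))) (*-cancelʳ-≉ (proj₂ α[i]≉0) (begin
          (N * fromℕ r₁ + N) * α i k
            ≈⟨ trans (+-identityʳ _) (+-identityʳ _) ⟨
          (N * fromℕ r₁ + N) * α i k + 0# + 0#
            ≈⟨ +-cong (+-congˡ (MP.*ᵥ-≈𝟎 A₁ S≈0 i)) (trans (MP.∑-cong (β≈0 i)) (MP.∑-zero n₂)) ⟨
          (N * fromℕ r₁ + N) * α i k + (A₁ *ᵥ sums α) i + sums β i
            ≈⟨ eqA i k ⟩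
          x * α i k ∎))
      integral⇐ (integral₂ , integral-roots) x x-eigen | α , β , αβ≉0 , eqA , eqB | no S≉0 with x - N - D ≟ 0#
      -- Here `x - N` is the pole of `χ`, so `x` cannot be a coronal root; it is the integer
      -- `N + 2 r₂` instead.
      ... | yes z≈0 = IsInteger-cong N+D≈x (IsInteger-+ n₂ (IsInteger-+ r₂ (IsInteger-fromℕ r₂)))
        where
        N+D≈x : N + D ≈ x
        N+D≈x = begin
          N + D                    ≈⟨ +-congˡ (trans (+-congˡ z≈0) (+-identityʳ D)) ⟨
          N + (D + (x - N - D))    ≈⟨ trans (+-congˡ (-‿+-cancelˡ D (x - N))) (-‿+-cancelˡ N x) ⟩
          x                        ∎
      ... | no z≉0 = integral-roots (proj₁ listed) x (coronal-root⇐ G₂ reg₂ χ coronal {ν (proj₁ listed)} y*z≈N (trans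
            (solve 3 (λ n m y → n :+ n :* m :+ n :* y := n :* m :+ (n :+ n :* y))
                 refl N (ν (proj₁ listed)) y) (proj₂ listed)))
        where
        S T : Vector Carrier n₁
        S = sums α
        T = sums β
        z = x - N - D
        z⁻¹ = proj₁ (inverse z z≉0)
        -- The value of the coronal at `x - N`, and also the ratio of `T` to `S`.
        y = N * z⁻¹
        y*z≈N : y * z ≈ N
        y*z≈N = begin
          N * z⁻¹ * z    ≈⟨ solve 3 (λ n i z → n :* i :* z := n :* (z :* i)) refl N z⁻¹ z ⟩
          N * (z * z⁻¹)  ≈⟨ *-congˡ (proj₂ (inverse z z≉0)) ⟩
          N * 1#         ≈⟨ *-identityʳ N ⟩
          N              ∎

        -- Summation over `k` replaces `Q₂` by the scalar `D`, and the term `S i`, constant in `k`,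
        -- is counted `N` times.
        ∑-eqB : ∀ i → N * T i + D * T i + N * S i ≈ x * T i
        ∑-eqB i = begin
          N * T i + D * T i + N * S i
            ≈⟨ +-cong (+-cong (MP.*-distribˡ-∑ N (β i)) (sym (MP.regular-∑-*ᵥ G₂ reg₂ (β i)))) (sym (MP.∑-const n₂ (S i))) ⟩
          ∑ (λ k → N * β i k) + ∑ (Q₂ *ᵥ β i) + ∑ {n₂} (λ _ → S i)
            ≈⟨ +-congʳ (MP.∑-distrib-+ (λ k → N * β i k) (Q₂ *ᵥ β i)) ⟨
          ∑ (λ k → N * β i k + (Q₂ *ᵥ β i) k) + ∑ {n₂} (λ _ → S i)
            ≈⟨ MP.∑-distrib-+ (λ k → N * β i k + (Q₂ *ᵥ β i) k) (λ _ → S i) ⟨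
          ∑ (λ k → N * β i k + (Q₂ *ᵥ β i) k + S i)
            ≈⟨ MP.∑-cong (eqB i) ⟩
          ∑ (λ k → x * β i k)
            ≈⟨ MP.*-distribˡ-∑ x (β i) ⟨
          x * T i ∎

        -- Cancelling `(N + D) T` from the summed `b`-equation leaves `z T = N S`; divide by the
        -- nonzero `z`.
        T≈yS : ∀ i → T i ≈ y * S i
        T≈yS i = *-cancelʳ-≉ z≉0 (begin
          T i * z              ≈⟨ *-comm (T i) z ⟩
          z * T i              ≈⟨ +-cancelˡ (N * T i + D * T i) _ _ (begin
            N * T i + D * T i + z * T i
              ≈⟨ solve 4 (λ n d z t → n :* t :+ d :* t :+ z :* t := (n :+ (d :+ z)) :* t)
                   refl N D z (T i) ⟩
            (N + (D + z)) * T i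
              ≈⟨ *-congʳ (trans (+-congˡ (-‿+-cancelˡ D (x - N))) (-‿+-cancelˡ N x)) ⟩
            x * T i                      ≈⟨ ∑-eqB i ⟨
            N * T i + D * T i + N * S i  ∎) ⟩
          N * S i              ≈⟨ *-congʳ y*z≈N ⟨
          y * z * S i          ≈⟨ solve 3 (λ y z s → y :* z :* s := y :* s :* z) refl y z (S i) ⟩
          y * S i * z          ∎)

        -- Summing the `a`-equation over `k` multiplies `A₁ S + T`, constant in `k`, by `N`. Thus
        -- `A₁` acquires the same factor that `r₁` already had, and `N r₁ S + N A₁ S` is `N Q₁ S`;
        -- `T = y S` eliminates `T`.
        S-eigen : ∀ i → N * (Q₁ *ᵥ S) i + (N + N * y) * S i ≈ x * S i
        S-eigen i = begin
          N * (Q₁ *ᵥ S) i + (N + N * y) * S i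
            ≈⟨ +-congʳ (*-congˡ (MP.regular-*ᵥ G₁ reg₁ S i)) ⟩
          N * (fromℕ r₁ * S i + (A₁ *ᵥ S) i) + (N + N * y) * S i
            ≈⟨ solve 5 (λ n r s a y → n :* (r :* s :+ a) :+ (n :+ n :* y) :* s
                 := (n :* r :+ n) :* s :+ (n :* a :+ n :* (y :* s)))
                 refl N (fromℕ r₁) (S i) ((A₁ *ᵥ S) i) y ⟩
          (N * fromℕ r₁ + N) * S i + (N * (A₁ *ᵥ S) i + N * (y * S i))
            ≈⟨ +-cong (MP.*-distribˡ-∑ _ (α i)) (trans (+-congˡ (*-congˡ (sym (T≈yS i)))) (sym (distribˡ N _ _))) ⟩
          ∑ (λ k → (N * fromℕ r₁ + N) * α i k) + N * ((A₁ *ᵥ S) i + T i)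
            ≈⟨ +-congˡ (MP.∑-const n₂ _) ⟨
          ∑ (λ k → (N * fromℕ r₁ + N) * α i k) + ∑ {n₂} (λ _ → (A₁ *ᵥ S) i + T i)
            ≈⟨ MP.∑-distrib-+ (λ k → (N * fromℕ r₁ + N) * α i k) _ ⟨
          ∑ (λ k → (N * fromℕ r₁ + N) * α i k + ((A₁ *ᵥ S) i + T i))
            ≈⟨ MP.∑-cong (λ k → trans (sym (+-assoc _ _ _)) (eqA i k)) ⟩
          ∑ (λ k → x * α i k)
            ≈⟨ MP.*-distribˡ-∑ x (α i) ⟨
          x * S i ∎

        listed : ∃[ j ] N * ν j + (N + N * y) ≈ x
        listed = eigenvalue-listed Q₁ ν eigenvalues S S≉0 S-eigen

theorem7 :
    ∀ {c ℓ₁ ℓ₂} (F : RealClosedField c ℓ₁ ℓ₂) →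
    let open RealClosedField F using (Carrier)
        open Over F
    in
    ∀ {n₁ n₂ r₁ r₂ : ℕ} .{{_ : NonZero n₁}} .{{_ : NonZero n₂}}
    (G₁ : Graph n₁) (G₂ : Graph n₂) →
    Regular r₁ G₁ → Regular r₂ G₂ →
    (ν : Fin n₁ → Carrier) → AreEigenvalues (signlessLaplacian G₁) ν →
    (χ : RationalFunction) → IsCoronal (signlessLaplacian G₂) χ →
    SignlessLaplacianIntegral (G₁ ⊛ G₂)
      ⇔ (SignlessLaplacianIntegral G₂
          × (∀ (i : Fin n₁) (x : Carrier) → IsCoronalRoot n₂ (ν i) χ x → IsInteger x))
theorem7 F G₁ G₂ reg₁ reg₂ ν eigenvalues χ coronal =
  mk⇔ (integral⇒ G₁ G₂ reg₁ reg₂ ν eigenvalues χ coronal) (integral⇐ G₁ G₂ reg₁ reg₂ ν eigenvalues χ coronal)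
  where open ProductSpectrum F
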